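{- Let $d\ge 1$ and $q\ge 2$, let $\mathfrak A$ be a $d$-colored ordinal, and put $k=|\rho_{q-1}(\mathfrak A)|$. Then there is a $d$-colored ordinal $\mathfrak B$ such that $\mathfrak B\equiv_q\mathfrak A$ and $\operatorname{otp}(B)\le\omega^k$.
   Context: A $d$-colored ordinal is a structure $\mathfrak A=(A,<,C_0,\dots,C_{d-1})$ where $(A,<)$ is an ordinal (well-order) and the unary predicates $C_i$ partition $A$; empty domains and empty color classes are allowed. $\operatorname{otp}(A)$ is the order type of $(A,<)$. $\mathfrak A\equiv_q\mathfrak B$ means agreement on all first-order sentences of quantifier rank at most $q$. $[[\mathfrak A]]^q$ denotes the $q$-characteristic sentence of $\mathfrak A$, so $[[\mathfrak A]]^q$ and $[[\mathfrak B]]^q$ are identified iff $\mathfrak A\equiv_q\mathfrak B$. For $a\in A$ of color $i$, the $q$-character of $a$ is $\rho_q^{\mathfrak A}(a)=(i,[[\mathfrak A_{<a}]]^q,[[\mathfrak A_{>a}]]^q)$, where $\mathfrak A_{<a},\mathfrak A_{>a}$ are the substructures on $\{b:b<a\}$ and $\{b:b>a\}$; and $\rho_q(\mathfrak A)=\{\rho_q^{\mathfrak A}(a):a\in A\}$. -}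

module Defs where

open import Data.Fin.Base using (Fin)
import Data.Fin.Induction as Fin
import Data.Fin.Properties as Fin
open import Data.Nat.Base as ℕ using (ℕ; _≤_; _⊔_)
import Data.Nat.Induction as ℕ
import Data.Nat.Properties as ℕ
open import Data.Product.Base using (∃-syntax; _×_; _,_; proj₁)
open import Data.Product.Relation.Binary.Lex.Strict using (×-strictTotalOrder; ×-wellFounded')
open import Data.Product.Relation.Binary.Pointwise.NonDependent using (×-setoid)
open import Data.Sum.Base using (_⊎_)
open import Data.Vec.Functional using (Vector; []; _∷_)
open import Function.Base using (_∘_)
open import Function.Bundles using (Bijection; _⇔_)
import Function.Properties.Equivalence as ⇔
open import Induction.WellFounded using (WellFounded)
open import Level using (Level; 0ℓ) renaming (suc to lsuc; _⊔_ to _⊔ˡ_)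
open import Relation.Binary.Bundles using (Setoid; StrictTotalOrder)
import Relation.Binary.Construct.On as On
open import Relation.Binary.Definitions using (_Respects_)
open import Relation.Binary.PropositionalEquality.Core as ≡ using (_≡_)
import Relation.Binary.PropositionalEquality.Properties as ≡
open import Relation.Nullary.Negation.Core using (¬_)
open import Relation.Unary using (Pred; _∈_)

private
  variable
    a b ℓ : Level
    d n   : ℕ

-- Ordinals are represented by well-ordered setoids; equality of ordinals
-- (isomorphism) is never needed, only the comparison _≼_.

record Ordinal (a : Level) : Set (lsuc a) where
  field
    strictTotalOrder : StrictTotalOrder a a a
  open StrictTotalOrder strictTotalOrder public
    using (Carrier; _≈_; _<_)
  field
    <-wellFounded : WellFounded _<_

-- α ≼ β: α is isomorphic to an initial segment of β (possibly all of β).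
-- Since < is trichotomous on α, monotonicity makes `to` injective and
-- order-reflecting.

record _≼_ (α : Ordinal a) (β : Ordinal b) : Set (a ⊔ˡ b) where
  private
    module α = Ordinal α
    module β = Ordinal β
  field
    to      : α.Carrier → β.Carrier
    to-cong : ∀ {x y} → x α.≈ y → to x β.≈ to y
    to-mono : ∀ {x y} → x α.< y → to x β.< to y
    initial : ∀ {x z} → z β.< to x → ∃[ y ] to y β.≈ z

infix 4 _≼_

𝟙 : Ordinal 0ℓ
𝟙 = record
  { strictTotalOrder = Fin.<-strictTotalOrder 1
  ; <-wellFounded    = Fin.<-wellFounded
  }

ω : Ordinal 0ℓ
ω = record
  { strictTotalOrder = ℕ.<-strictTotalOrder
  ; <-wellFounded    = ℕ.<-wellFounded
  }

-- α · β is β copies of α: the coordinate in β is the most significant one,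
-- and the stdlib lexicographic order compares first components first.

_·_ : Ordinal a → Ordinal a → Ordinal a
α · β = record
  { strictTotalOrder = ×-strictTotalOrder β.strictTotalOrder α.strictTotalOrder
  ; <-wellFounded    = ×-wellFounded' βS.Eq.trans βS.<-respʳ-≈
                         β.<-wellFounded α.<-wellFounded
  }
  where
  module α = Ordinal α
  module β = Ordinal β
  module βS = StrictTotalOrder β.strictTotalOrder

infixl 7 _·_

_^ᴼ_ : Ordinal 0ℓ → ℕ → Ordinal 0ℓ
α ^ᴼ ℕ.zero  = 𝟙
α ^ᴼ ℕ.suc k = (α ^ᴼ k) · α

infixr 8 _^ᴼ_

record ColoredOrdinal (d : ℕ) (a : Level) : Set (lsuc a) where
  field
    otp : Ordinal a
  open Ordinal otp public
  field
    C        : Fin d → Pred Carrier a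
    C-resp   : ∀ i → C i Respects _≈_
    cover    : ∀ x → ∃[ i ] x ∈ C i
    disjoint : ∀ {i j x} → x ∈ C i → x ∈ C j → i ≡ j

  color : Carrier → Fin d
  color x = proj₁ (cover x)

open ColoredOrdinal using (Carrier; otp; color)

restrict : (𝔄 : ColoredOrdinal d a) → Pred (Carrier 𝔄) a → ColoredOrdinal d a
restrict 𝔄 P = record
  { otp = record
    { strictTotalOrder = On.strictTotalOrder A.strictTotalOrder (proj₁ {B = P})
    ; <-wellFounded    = On.wellFounded proj₁ A.<-wellFounded
    }
  ; C        = λ i → A.C i ∘ proj₁
  ; C-resp   = λ i → A.C-resp i
  ; cover    = A.cover ∘ proj₁
  ; disjoint = A.disjoint
  }
  where module A = ColoredOrdinal 𝔄

_↾<_ : (𝔄 : ColoredOrdinal d a) → Carrier 𝔄 → ColoredOrdinal d a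
𝔄 ↾< x = restrict 𝔄 (λ y → y < x)
  where open ColoredOrdinal 𝔄 using (_<_)

_↾>_ : (𝔄 : ColoredOrdinal d a) → Carrier 𝔄 → ColoredOrdinal d a
𝔄 ↾> x = restrict 𝔄 (λ y → x < y)
  where open ColoredOrdinal 𝔄 using (_<_)

-- First-order formulas over the signature (<, C₀, …, C_{d-1}) with equality.
-- Formula d n has its free variables among n de Bruijn variables;
-- variable zero is the one bound by the innermost quantifier.

data Formula (d n : ℕ) : Set where
  _≐_ _≺_   : Fin n → Fin n → Formula d n
  col       : Fin d → Fin n → Formula d n
  ¬′_       : Formula d n → Formula d n
  _∧′_ _∨′_ : Formula d n → Formula d n → Formula d n
  ∃′_ ∀′_   : Formula d (ℕ.suc n) → Formula d n

Sentence : ℕ → Set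
Sentence d = Formula d 0

qr : Formula d n → ℕ
qr (x ≐ y)   = 0
qr (x ≺ y)   = 0
qr (col i x) = 0
qr (¬′ φ)    = qr φ
qr (φ ∧′ ψ)  = qr φ ⊔ qr ψ
qr (φ ∨′ ψ)  = qr φ ⊔ qr ψ
qr (∃′ φ)    = ℕ.suc (qr φ)
qr (∀′ φ)    = ℕ.suc (qr φ)

module _ (𝔄 : ColoredOrdinal d a) where
  private module A = ColoredOrdinal 𝔄

  Sat : Vector A.Carrier n → Formula d n → Set a
  Sat v (x ≐ y)   = v x A.≈ v y
  Sat v (x ≺ y)   = v x A.< v y
  Sat v (col i x) = v x ∈ A.C i
  Sat v (¬′ φ)    = ¬ Sat v φ
  Sat v (φ ∧′ ψ)  = Sat v φ × Sat v ψ
  Sat v (φ ∨′ ψ)  = Sat v φ ⊎ Sat v ψ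
  Sat v (∃′ φ)    = ∃[ x ] Sat (x ∷ v) φ
  Sat v (∀′ φ)    = ∀ x → Sat (x ∷ v) φ

_⊨_ : ColoredOrdinal d a → Sentence d → Set a
𝔄 ⊨ φ = Sat 𝔄 [] φ

_≡[_]_ : ColoredOrdinal d a → ℕ → ColoredOrdinal d b → Set (a ⊔ˡ b)
_≡[_]_ {d = d} 𝔄 q 𝔅 = (φ : Sentence d) → qr φ ≤ q → (𝔄 ⊨ φ) ⇔ (𝔅 ⊨ φ)

infix 4 _⊨_ _≡[_]_

-- The q-characteristics [[𝔄]]^q, as the quotient (setoid) of the colored
-- ordinals by ≡_q: 𝔄, regarded as an element of this setoid, is [[𝔄]]^q.

Characteristic : (d : ℕ) (a : Level) → ℕ → Setoid (lsuc a) a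
Characteristic d a q = record
  { Carrier       = ColoredOrdinal d a
  ; _≈_           = _≡[ q ]_
  ; isEquivalence = record
    { refl  = λ φ _ → ⇔.refl
    ; sym   = λ e φ r → ⇔.sym (e φ r)
    ; trans = λ e f φ r → ⇔.trans (e φ r) (f φ r)
    }
  }

Character : (d : ℕ) (a : Level) → ℕ → Setoid (lsuc a) a
Character d a q =
  ×-setoid (≡.setoid (Fin d))
    (×-setoid (Characteristic d a q) (Characteristic d a q))

character : (q : ℕ) (𝔄 : ColoredOrdinal d a) →
            Carrier 𝔄 → Setoid.Carrier (Character d a q)
character q 𝔄 x = color 𝔄 x , 𝔄 ↾< x , 𝔄 ↾> x

ρ : (q : ℕ) (𝔄 : ColoredOrdinal d a) → Pred (Setoid.Carrier (Character d a q)) a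
ρ {d = d} {a = a} q 𝔄 c = ∃[ x ] c ≈ character q 𝔄 x
  where open Setoid (Character d a q) using (_≈_)

-- The subset P of S has exactly k elements, counted up to the equality of S.

HasCardinality : (S : Setoid a b) → Pred (Setoid.Carrier S) ℓ → ℕ → Set (a ⊔ˡ b ⊔ˡ ℓ)
HasCardinality S P k =
  Bijection (≡.setoid (Fin k)) (On.setoid S (proj₁ {B = P}))

{-# OPTIONS --safe #-}

-- Put p = q - 1. Two structures are ≡_q iff they realise the same p-characters, so it suffices to
-- find an order of type at most ω^k realising exactly the p-characters of 𝔄. If y < x have the
-- same character, cutting out [y, x) preserves the characters of all other points. By induction on
-- k, an interval I that sees at most k characters can be replaced by one of type at most ω^k:
-- * if some character is bounded in I, split I at a point x above all its occurrences and cut so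
--   that x becomes the first occurrence of its own character; both sides miss a character;
-- * otherwise choose x < y of equal character in I such that [x, y) meets all characters. The
--   cuts reduce [x, y) to a finite sum G of pieces that see fewer characters, and I is replaced
--   by G^ω.
-- That G^ω is a correct replacement is shown by a back-and-forth argument: call an interval
-- 0-deep always, and (l+1)-deep if every l-character occurs in it between two l-deep intervals.
-- Sufficiently deep intervals whose end points have the same characters are equivalent, while
-- shallowness is visible to the game, which then answers locally from the nearer end point.
-- To obtain all k characters, apply this between the first occurrences of the characters.

module Submission where

open import Axiom.ExcludedMiddle using (ExcludedMiddle)
open import Data.Empty using (⊥; ⊥-elim)
open import Data.Fin.Base using (Fin; zero; suc; combine; remQuot; finToFun; funToFin)
open import Data.Fin.Properties as Fin using (combine-injective; combine-remQuot; finToFun-funToFin; funToFin-finToFin)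
open import Data.List.Base using (List; []; _∷_; length; filter; allFin; lookup)
open import Data.List.Membership.Propositional using (_∈_; lose)
open import Data.List.Membership.Propositional.Properties using (∈-filter⁺; ∈-filter⁻; ∈-lookup; ∈-allFin)
open import Data.List.Properties using (filter-notAll)
import Data.List.Relation.Unary.All as All
open import Data.List.Relation.Unary.AllPairs.Core using ([]; _∷_)
open import Data.List.Relation.Unary.Any as Any using (here; there)
open import Data.List.Relation.Unary.Any.Properties using (lookup-index)
open import Data.List.Relation.Unary.Unique.Propositional using (Unique)
import Data.List.Relation.Unary.Unique.Propositional.Properties as Unique
open import Data.Maybe.Base as Maybe using (Maybe; just; nothing)
open import Data.Nat.Base as ℕ using (ℕ; zero; suc; _≤_; _≤′_; ≤′-reflexive; ≤′-step; z≤n; s≤s; pred; _+_; _∸_) renaming (_*_ to _*ℕ_; _^_ to _^ℕ_)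
open import Data.Nat.Properties as ℕ using (≤⇒≤′; pred[n]≤n; ≤-trans; n≤1+n; m≤n⇒m≤1+n)
open import Data.Product.Base using (Σ; Σ-syntax; ∃-syntax; _×_; _,_; proj₁; proj₂)
open import Data.Sum.Base using (_⊎_; inj₁; inj₂; swap)
open import Data.Unit.Polymorphic.Base using (⊤; tt)
open import Data.Vec.Functional using (Vector) renaming ([] to []ᵛ; _∷_ to _∷ᵛ_)
open import Function.Base using (_∘_; id; case_of_)
open import Function.Bundles using (Equivalence; mk⇔)
open import Induction.WellFounded as WF using (WellFounded; Acc; acc)
open import Level using (Level; 0ℓ; _⊔_) renaming (suc to lsuc)
open import Relation.Binary.Bundles using (Setoid; StrictTotalOrder)
import Relation.Binary.Construct.On as On
open import Relation.Binary.Definitions using (Tri; tri<; tri≈; tri>)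
open import Relation.Binary.PropositionalEquality using (_≡_; _≢_; refl; sym; trans; cong; cong₂; subst)
open import Relation.Nullary using (¬_; ¬?; Dec; yes; no; contradiction)
open import Relation.Unary using (Pred)
open import Defs

-- For G^ω this looks circular, since the characters of its points depend on the type of G^ω ⊕ R,
-- the very thing to be identified with the type of I ⊕ R. The circle is broken by induction on the
-- rank j of that tail; what lies to the left of a point is controlled at full rank p throughout,
-- because H absorbs G. A second obstacle is that nothing relates the beginnings of I and G^ω. Both
-- are therefore compared after prepending the same number of copies of G, large enough to be deep.
-- A point shallow from the left then lies in the common prefix, and the prefix is discarded
-- afterwards: H absorbs it on one side, I ⊕ R on the other. Realising all k characters does not
-- raise the exponent: an interval below a point can be freed of the character of that point, so it
-- gets type at most ω^(k-1), and finitely many such pieces in front of the last one, of type at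
-- most ω^k, are absorbed by ω^k.

private
  variable
    a b c g ℓ ℓ′ : Level
    d i j k m n : ℕ

-- There is no separate equality: incomparable points are regarded as equal.

record Lin (d : ℕ) (a : Level) : Set (lsuc a) where
  infix 4 _<_
  field
    Pt         : Set a
    _<_        : Pt → Pt → Set a
    color      : Pt → Fin d
    asym       : ∀ {x y} → x < y → ¬ y < x
    cotrans    : ∀ {x y} z → x < y → x < z ⊎ z < y
    color-resp : ∀ {x y} → ¬ x < y → ¬ y < x → color x ≡ color y

  irrefl : ∀ {x} → ¬ x < x
  irrefl p = asym p p

  <-trans : ∀ {x y z} → x < y → y < z → x < z
  <-trans {z = z} p q with cotrans z p
  ... | inj₁ r = r
  ... | inj₂ r = contradiction q (asym r)

  <-≤-trans : ∀ {x y z} → x < y → ¬ z < y → x < z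
  <-≤-trans {z = z} p q with cotrans z p
  ... | inj₁ r = r
  ... | inj₂ r = contradiction r q

  ≤-<-trans : ∀ {x y z} → ¬ y < x → y < z → x < z
  ≤-<-trans {x} p q with cotrans x q
  ... | inj₁ r = contradiction r p
  ... | inj₂ r = r


open Lin using (Pt; color)

infix 4 _∋_<_
_∋_<_ : (A : Lin d a) → Pt A → Pt A → Set a
A ∋ x < y = Lin._<_ A x y

-- Restrictions, ordered sums and isomorphisms of colored orders.

infixl 8 _∣_ _↓_ _↑_

_∣_ : (A : Lin d a) → Pred (Pt A) a → Lin d a
A ∣ P = record
  { Pt         = Σ A.Pt P
  ; _<_        = λ x y → proj₁ x A.< proj₁ y
  ; color      = A.color ∘ proj₁
  ; asym       = A.asym
  ; cotrans    = λ z → A.cotrans (proj₁ z)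
  ; color-resp = A.color-resp
  }
  where module A = Lin A

_↓_ _↑_ : (A : Lin d a) → Pt A → Lin d a
A ↓ x = A ∣ (λ y → A ∋ y < x)
A ↑ x = A ∣ (λ y → A ∋ x < y)

point : Fin d → Lin d 0ℓ
point i = record
  { Pt         = ⊤
  ; _<_        = λ _ _ → ⊥
  ; color      = λ _ → i
  ; asym       = λ ()
  ; cotrans    = λ _ ()
  ; color-resp = λ _ _ → refl
  }

∅ : Lin d a
∅ = record
  { Pt         = Level.Lift _ ⊥
  ; _<_        = λ ()
  ; color      = λ ()
  ; asym       = λ {x} → ⊥-elim (Level.lower x)
  ; cotrans    = λ {x} → ⊥-elim (Level.lower x)
  ; color-resp = λ {x} → ⊥-elim (Level.lower x)
  }

module _ (A : Lin d a) (B : Lin d b) where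
  private
    module A = Lin A
    module B = Lin B

    lt : A.Pt ⊎ B.Pt → A.Pt ⊎ B.Pt → Set (a ⊔ b)
    lt (inj₁ x) (inj₁ y) = Level.Lift b (x A.< y)
    lt (inj₁ x) (inj₂ y) = ⊤
    lt (inj₂ x) (inj₁ y) = Level.Lift _ ⊥
    lt (inj₂ x) (inj₂ y) = Level.Lift a (x B.< y)

    col⊕ : A.Pt ⊎ B.Pt → Fin d
    col⊕ (inj₁ x) = A.color x
    col⊕ (inj₂ x) = B.color x

    asym⊕ : ∀ {x y} → lt x y → ¬ lt y x
    asym⊕ {inj₁ x} {inj₁ y} (Level.lift p) (Level.lift q) = A.asym p q
    asym⊕ {inj₁ x} {inj₂ y} p (Level.lift ())
    asym⊕ {inj₂ x} {inj₁ y} (Level.lift ())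
    asym⊕ {inj₂ x} {inj₂ y} (Level.lift p) (Level.lift q) = B.asym p q

    cotrans⊕ : ∀ {x y} z → lt x y → lt x z ⊎ lt z y
    cotrans⊕ {inj₁ x} {inj₁ y} (inj₁ z) (Level.lift p) with A.cotrans z p
    ... | inj₁ q = inj₁ (Level.lift q)
    ... | inj₂ q = inj₂ (Level.lift q)
    cotrans⊕ {inj₁ x} {inj₁ y} (inj₂ z) p = inj₁ _
    cotrans⊕ {inj₁ x} {inj₂ y} (inj₁ z) p = inj₂ _
    cotrans⊕ {inj₁ x} {inj₂ y} (inj₂ z) p = inj₁ _
    cotrans⊕ {inj₂ x} {inj₁ y} z (Level.lift ())
    cotrans⊕ {inj₂ x} {inj₂ y} (inj₁ z) p = inj₂ _
    cotrans⊕ {inj₂ x} {inj₂ y} (inj₂ z) (Level.lift p) with B.cotrans z p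
    ... | inj₁ q = inj₁ (Level.lift q)
    ... | inj₂ q = inj₂ (Level.lift q)

    resp⊕ : ∀ {x y} → ¬ lt x y → ¬ lt y x → col⊕ x ≡ col⊕ y
    resp⊕ {inj₁ x} {inj₁ y} p q = A.color-resp (p ∘ Level.lift) (q ∘ Level.lift)
    resp⊕ {inj₁ x} {inj₂ y} p q = contradiction _ p
    resp⊕ {inj₂ x} {inj₁ y} p q = contradiction _ q
    resp⊕ {inj₂ x} {inj₂ y} p q = B.color-resp (p ∘ Level.lift) (q ∘ Level.lift)

  infixr 6 _⊕_
  _⊕_ : Lin d (a ⊔ b)
  _⊕_ = record
    { Pt         = A.Pt ⊎ B.Pt
    ; _<_        = lt
    ; color      = col⊕
    ; asym       = λ {x} → asym⊕ {x}
    ; cotrans    = λ {x} → cotrans⊕ {x}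
    ; color-resp = λ {x} → resp⊕ {x}
    }

infix 4 _≅_

-- A relation instead of two inverse maps: incomparable points count as equal, so inverse laws up to
-- `≡` would fail (in `split-≅` all points incomparable with `y` share one partner). Preserving and
-- reflecting `<` makes the relation bijective up to incomparability.
record _≅_ (A : Lin d a) (B : Lin d b) : Set (lsuc (a ⊔ b)) where
  private
    module A = Lin A
    module B = Lin B
  field
    _~_     : A.Pt → B.Pt → Set (a ⊔ b)
    to      : ∀ x → ∃[ y ] x ~ y
    from    : ∀ y → ∃[ x ] x ~ y
    color-≡ : ∀ {x y} → x ~ y → A.color x ≡ B.color y
    to-<    : ∀ {x x′ y y′} → x ~ y → x′ ~ y′ → x A.< x′ → y B.< y′
    from-<  : ∀ {x x′ y y′} → x ~ y → x′ ~ y′ → y B.< y′ → x A.< x′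

module _ {A : Lin d a} {B : Lin d b} (f : A ≅ B) where
  open _≅_ f

  ∣-≅ : ∀ {P Q} → (∀ {x y} → x ~ y → P x → Q y) → (∀ {x y} → x ~ y → Q y → P x) →
        A ∣ P ≅ B ∣ Q
  ∣-≅ p q = record
    { _~_     = λ x y → proj₁ x ~ proj₁ y
    ; to      = λ { (x , Px) → let y , r = to x in (y , p r Px) , r }
    ; from    = λ { (y , Qy) → let x , r = from y in (x , q r Qy) , r }
    ; color-≡ = color-≡
    ; to-<    = to-<
    ; from-<  = from-<
    }

  ↓-≅ : ∀ {x y} → x ~ y → A ↓ x ≅ B ↓ y
  ↓-≅ r = ∣-≅ (λ s → to-< s r) (λ s → from-< s r)

  ↑-≅ : ∀ {x y} → x ~ y → A ↑ x ≅ B ↑ y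
  ↑-≅ r = ∣-≅ (λ s → to-< r s) (λ s → from-< r s)

≅-refl : {A : Lin d a} → A ≅ A
≅-refl = record
  { _~_     = _≡_
  ; to      = λ x → x , refl
  ; from    = λ x → x , refl
  ; color-≡ = λ { refl → refl }
  ; to-<    = λ { refl refl p → p }
  ; from-<  = λ { refl refl p → p }
  }

∣-ext : {A : Lin d a} {P Q : Pred (Pt A) a} →
        (∀ {x} → P x → Q x) → (∀ {x} → Q x → P x) → A ∣ P ≅ A ∣ Q
∣-ext p q = ∣-≅ ≅-refl (λ { refl → p }) (λ { refl → q })

∣-∣-≅ : {A : Lin d a} {P R : Pred (Pt A) a} {Q : Pred (Σ (Pt A) P) a} →
        (∀ {x} (p : P x) → Q (x , p) → R x) → (∀ {x} → R x → Σ[ p ∈ P x ] Q (x , p)) →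
        A ∣ P ∣ Q ≅ A ∣ R
∣-∣-≅ f g = record
  { _~_     = λ x y → proj₁ (proj₁ x) ≡ proj₁ y
  ; to      = λ { ((x , p) , q) → (x , f p q) , refl }
  ; from    = λ { (x , r) → let p , q = g r in ((x , p) , q) , refl }
  ; color-≡ = λ { refl → refl }
  ; to-<    = λ { refl refl p → p }
  ; from-<  = λ { refl refl p → p }
  }

∣-swap-≅ : {A : Lin d a} {P Q : Pred (Pt A) a} → A ∣ P ∣ (Q ∘ proj₁) ≅ A ∣ Q ∣ (P ∘ proj₁)
∣-swap-≅ = record
  { _~_     = λ x y → proj₁ (proj₁ x) ≡ proj₁ (proj₁ y)
  ; to      = λ { ((x , p) , q) → ((x , q) , p) , refl }
  ; from    = λ { ((x , q) , p) → ((x , p) , q) , refl }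
  ; color-≡ = λ { refl → refl }
  ; to-<    = λ { refl refl p → p }
  ; from-<  = λ { refl refl p → p }
  }

≅-sym : {A : Lin d a} {B : Lin d b} → A ≅ B → B ≅ A
≅-sym f = record
  { _~_     = λ y x → F._~_ x y
  ; to      = F.from
  ; from    = F.to
  ; color-≡ = sym ∘ F.color-≡
  ; to-<    = F.from-<
  ; from-<  = F.to-<
  }
  where module F = _≅_ f

∣-true-≅ : {A : Lin d a} {P : Pred (Pt A) a} → (∀ x → P x) → A ∣ P ≅ A
∣-true-≅ f = record
  { _~_     = λ x y → proj₁ x ≡ y
  ; to      = λ { (x , _) → x , refl }
  ; from    = λ x → (x , f x) , refl
  ; color-≡ = λ { refl → refl }
  ; to-<    = λ { refl refl p → p }
  ; from-<  = λ { refl refl p → p }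
  }

module _ {A : Lin d a} {B : Lin d b} where

  ⊕-↓ˡ : ∀ {x} → (A ⊕ B) ↓ inj₁ x ≅ A ↓ x
  ⊕-↓ˡ {x} = record
    { _~_     = _~_
    ; to      = λ { (inj₁ y , Level.lift p) → (y , p) , same ; (inj₂ y , Level.lift ()) }
    ; from    = λ { (y , p) → (inj₁ y , Level.lift p) , same }
    ; color-≡ = λ { same → refl }
    ; to-<    = λ { same same (Level.lift p) → p }
    ; from-<  = λ { same same p → Level.lift p }
    }
    where
    data _~_ : Pt ((A ⊕ B) ↓ inj₁ x) → Pt (A ↓ x) → Set (a ⊔ b) where
      same : ∀ {y p q} → (inj₁ y , p) ~ (y , q)

  ⊕-↑ˡ : ∀ {x} → (A ⊕ B) ↑ inj₁ x ≅ A ↑ x ⊕ B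
  ⊕-↑ˡ {x} = record
    { _~_     = _~_
    ; to      = λ { (inj₁ y , Level.lift p) → inj₁ (y , p) , left
                  ; (inj₂ y , _) → inj₂ y , right }
    ; from    = λ { (inj₁ (y , p)) → (inj₁ y , Level.lift p) , left
                  ; (inj₂ y) → (inj₂ y , tt) , right }
    ; color-≡ = λ { left → refl ; right → refl }
    ; to-<    = λ { left left p → p ; left right _ → tt
                  ; right left (Level.lift ()) ; right right p → p }
    ; from-<  = λ { left left p → p ; left right _ → tt
                  ; right left (Level.lift ()) ; right right p → p }
    }
    where
    data _~_ : Pt ((A ⊕ B) ↑ inj₁ x) → Pt (A ↑ x ⊕ B) → Set (a ⊔ b) where
      left  : ∀ {y p q} → (inj₁ y , p) ~ inj₁ (y , q)
      right : ∀ {y p} → (inj₂ y , p) ~ inj₂ y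

  ⊕-↓ʳ : ∀ {x} → (A ⊕ B) ↓ inj₂ x ≅ A ⊕ B ↓ x
  ⊕-↓ʳ {x} = record
    { _~_     = _~_
    ; to      = λ { (inj₁ y , _) → inj₁ y , left
                  ; (inj₂ y , Level.lift p) → inj₂ (y , p) , right }
    ; from    = λ { (inj₁ y) → (inj₁ y , tt) , left
                  ; (inj₂ (y , p)) → (inj₂ y , Level.lift p) , right }
    ; color-≡ = λ { left → refl ; right → refl }
    ; to-<    = λ { left left p → p ; left right _ → tt
                  ; right left (Level.lift ()) ; right right p → p }
    ; from-<  = λ { left left p → p ; left right _ → tt
                  ; right left (Level.lift ()) ; right right p → p }
    }
    where
    data _~_ : Pt ((A ⊕ B) ↓ inj₂ x) → Pt (A ⊕ B ↓ x) → Set (a ⊔ b) where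
      left  : ∀ {y p} → (inj₁ y , p) ~ inj₁ y
      right : ∀ {y p q} → (inj₂ y , p) ~ inj₂ (y , q)

  ⊕-↑ʳ : ∀ {x} → (A ⊕ B) ↑ inj₂ x ≅ B ↑ x
  ⊕-↑ʳ {x} = record
    { _~_     = _~_
    ; to      = λ { (inj₂ y , Level.lift p) → (y , p) , same ; (inj₁ y , Level.lift ()) }
    ; from    = λ { (y , p) → (inj₂ y , Level.lift p) , same }
    ; color-≡ = λ { same → refl }
    ; to-<    = λ { same same (Level.lift p) → p }
    ; from-<  = λ { same same p → Level.lift p }
    }
    where
    data _~_ : Pt ((A ⊕ B) ↑ inj₂ x) → Pt (B ↑ x) → Set (a ⊔ b) where
      same : ∀ {y p q} → (inj₂ y , p) ~ (y , q)

⊕-assoc : {A : Lin d a} {B : Lin d b} {C : Lin d c} → (A ⊕ B) ⊕ C ≅ A ⊕ B ⊕ C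
⊕-assoc {a = a} {b = b} {c = c} {A = A} {B} {C} = record
  { _~_     = _~_
  ; to      = λ { (inj₁ (inj₁ x)) → _ , left ; (inj₁ (inj₂ x)) → _ , middle ; (inj₂ x) → _ , right }
  ; from    = λ { (inj₁ x) → _ , left ; (inj₂ (inj₁ x)) → _ , middle ; (inj₂ (inj₂ x)) → _ , right }
  ; color-≡ = λ { left → refl ; middle → refl ; right → refl }
  ; to-<    = λ { left left (Level.lift (Level.lift p)) → Level.lift p ; left middle _ → tt ; left right _ → tt
                ; middle left (Level.lift (Level.lift ())) ; middle middle (Level.lift (Level.lift p)) → Level.lift (Level.lift p)
                ; middle right _ → Level.lift tt ; right left (Level.lift ()) ; right middle (Level.lift ())
                ; right right (Level.lift p) → Level.lift (Level.lift p) }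
  ; from-<  = λ { left left (Level.lift p) → Level.lift (Level.lift p) ; left middle _ → Level.lift tt
                ; left right _ → tt ; middle left (Level.lift ()) ; middle middle (Level.lift (Level.lift p)) → Level.lift (Level.lift p)
                ; middle right _ → tt ; right left (Level.lift ()) ; right middle (Level.lift (Level.lift ()))
                ; right right (Level.lift (Level.lift p)) → Level.lift p }
  }
  where
  data _~_ : Pt ((A ⊕ B) ⊕ C) → Pt (A ⊕ B ⊕ C) → Set (a ⊔ b ⊔ c) where
    left : ∀ {x} → inj₁ (inj₁ x) ~ inj₁ x
    middle : ∀ {x} → inj₁ (inj₂ x) ~ inj₂ (inj₁ x)
    right : ∀ {x} → inj₂ x ~ inj₂ (inj₂ x)

⊕-identityˡ : {B : Lin d b} → ∅ {a = a} ⊕ B ≅ B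
⊕-identityˡ {b = b} {a = a} {B = B} = record
  { _~_     = _~_
  ; to      = λ { (inj₂ x) → x , same }
  ; from    = λ x → inj₂ x , same
  ; color-≡ = λ { same → refl }
  ; to-<    = λ { same same (Level.lift p) → p }
  ; from-<  = λ { same same p → Level.lift p }
  }
  where
  data _~_ : Pt (∅ {a = a} ⊕ B) → Pt B → Set (a ⊔ b) where
    same : ∀ {x} → inj₂ x ~ x

⊕-identityʳ : {A : Lin d a} → A ⊕ ∅ {a = b} ≅ A
⊕-identityʳ {a = a} {b = b} {A = A} = record
  { _~_     = _~_
  ; to      = λ { (inj₁ x) → x , same }
  ; from    = λ x → inj₁ x , same
  ; color-≡ = λ { same → refl }
  ; to-<    = λ { same same (Level.lift p) → p }
  ; from-<  = λ { same same p → Level.lift p }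
  }
  where
  data _~_ : Pt (A ⊕ ∅ {a = b}) → Pt A → Set (a ⊔ b) where
    same : ∀ {x} → inj₁ x ~ x

cut-≅ : {A : Lin d a} {P Q R : Pred (Pt A) a} →
        (∀ {x} → P x → Q x ⊎ R x) → (∀ {x} → Q x → P x) → (∀ {x} → R x → P x) →
        (∀ {x y} → Q x → R y → A ∋ x < y) → A ∣ P ≅ A ∣ Q ⊕ A ∣ R
cut-≅ {a = a} {A = A} {P} {Q} {R} f g h Q<R = record
  { _~_     = _~_
  ; to      = λ { (x , p) → to p (f p) }
  ; from    = λ { (inj₁ (x , q)) → (x , g q) , left ; (inj₂ (x , r)) → (x , h r) , right }
  ; color-≡ = λ { left → refl ; right → refl }
  ; to-<    = λ { left left p → Level.lift p ; left right _ → tt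
                ; (right {r = r}) (left {q = q}) p → contradiction (Q<R q r) (Lin.asym A p)
                ; right right p → Level.lift p }
  ; from-<  = λ { left left (Level.lift p) → p
                ; (left {q = q}) (right {r = r}) _ → Q<R q r
                ; right left (Level.lift ()) ; right right (Level.lift p) → p }
  }
  where
  data _~_ : Pt (A ∣ P) → Pt (A ∣ Q ⊕ A ∣ R) → Set a where
    left  : ∀ {x p q} → (x , p) ~ inj₁ (x , q)
    right : ∀ {x p r} → (x , p) ~ inj₂ (x , r)
  to : ∀ {x} (p : P x) → Q x ⊎ R x → ∃[ y ] (x , p) ~ y
  to p (inj₁ q) = inj₁ (_ , q) , left
  to p (inj₂ r) = inj₂ (_ , r) , right

empty-≅ : {A : Lin d a} {B : Lin d b} → ¬ Pt A → ¬ Pt B → A ≅ B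
empty-≅ p q = record
  { _~_     = λ _ _ → ⊤
  ; to      = λ x → contradiction x p
  ; from    = λ y → contradiction y q
  ; color-≡ = λ {x} → contradiction x p
  ; to-<    = λ {x} → contradiction x p
  ; from-<  = λ {x} → contradiction x p
  }

minimal : (∀ {ℓ : Level} → ExcludedMiddle ℓ) → {A : Set a} {_<_ : A → A → Set b} →
          WellFounded _<_ → (P : A → Set c) → ∃[ x ] P x → ∃[ x ] P x × (∀ {y} → P y → ¬ y < x)
minimal em {_<_ = _<_} wf P (x , px) = go (wf x) px
  where
  go : ∀ {x} → Acc _<_ x → P x → ∃[ z ] P z × (∀ {y} → P y → ¬ y < z)
  go {x} (acc rs) px with em {P = ∃[ y ] P y × y < x}
  ... | yes (y , py , q) = go (rs q) py
  ... | no ¬q            = x , px , λ py q → ¬q (_ , py , q)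

-- Types and characters of bounded rank, coded by numbers.

module Types (em : ∀ {ℓ : Level} → ExcludedMiddle ℓ) (d : ℕ) where

  -- The numbers of codes for the j-types and for the j-characters.

  #type #char : ℕ → ℕ
  #type zero    = 1
  #type (suc j) = 2 ^ℕ #char j
  #char j = d *ℕ (#type j *ℕ #type j)

  Type Char : ℕ → Set
  Type j = Fin (#type j)
  Char j = Fin (#char j)

  encode : ∀ j → Fin d → Type j → Type j → Char j
  encode j i s t = combine i (combine s t)

  encode-injective : ∀ j {i i′ : Fin d} {s s′ t t′ : Type j} →
                     encode j i s t ≡ encode j i′ s′ t′ → i ≡ i′ × s ≡ s′ × t ≡ t′
  encode-injective j {i} {i′} {s} {s′} {t} {t′} p =
    let q , r   = combine-injective i (combine s t) i′ (combine s′ t′) p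
        r₁ , r₂ = combine-injective s t s′ t′ r
    in q , r₁ , r₂

  truth : Set a → Fin 2
  truth P with em {P = P}
  ... | yes _ = suc zero
  ... | no  _ = zero

  truth-yes : {P : Set a} → P → truth P ≡ suc zero
  truth-yes {P = P} p with em {P = P}
  ... | yes _ = refl
  ... | no ¬p = contradiction p ¬p

  truth-no : {P : Set a} → ¬ P → truth P ≡ zero
  truth-no {P = P} ¬p with em {P = P}
  ... | yes p = contradiction p ¬p
  ... | no _  = refl

  truth-elim : {P : Set a} → truth P ≡ suc zero → P
  truth-elim {P = P} eq with em {P = P}
  ... | yes p = p
  truth-elim () | no _

  truth-cong : {P : Set a} {Q : Set b} → (P → Q) → (Q → P) → truth P ≡ truth Q
  truth-cong {P = P} f g with em {P = P}
  ... | yes p = sym (truth-yes (f p))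
  ... | no ¬p = sym (truth-no (¬p ∘ g))

  funToFin-cong : {f g : Fin m → Fin n} → (∀ i → f i ≡ g i) → funToFin f ≡ funToFin g
  funToFin-cong {m = zero}  eq = refl
  funToFin-cong {m = suc m} eq = cong₂ combine (eq zero) (funToFin-cong (eq ∘ suc))

  -- A type is the characteristic function of the set of realised characters, written as a number.
  -- Codes in `Fin` make orders from different universe levels comparable and give finitely many
  -- values with decidable equality.
  tp  : ∀ j → Lin d a → Type j
  chr : ∀ j (A : Lin d a) → Pt A → Char j
  tp zero    A = zero
  tp (suc j) A = funToFin (λ k → truth (∃[ x ] chr j A x ≡ k))
  chr j A x = encode j (color A x) (tp j (A ↓ x)) (tp j (A ↑ x))

  infix 4 _≈[_]_

  record _≈[_]_ (A : Lin d a) (j : ℕ) (B : Lin d b) : Set where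
    constructor mk≈
    field tp-≡ : tp j A ≡ tp j B
  open _≈[_]_ public

  private
    variable
      A A′ : Lin d a
      B B′ : Lin d b
      C : Lin d c

  ≈-refl : A ≈[ j ] A
  ≈-refl = mk≈ refl

  ≈-sym : A ≈[ j ] B → B ≈[ j ] A
  ≈-sym (mk≈ p) = mk≈ (sym p)

  infixr 5 _⨾_

  _⨾_ : A ≈[ j ] B → B ≈[ j ] C → A ≈[ j ] C
  mk≈ p ⨾ mk≈ q = mk≈ (trans p q)

  record Similar (j : ℕ) (A : Lin d a) (B : Lin d b) (x : Pt A) (y : Pt B) : Set where
    constructor similar
    field
      color-≡ : color A x ≡ color B y
      below   : A ↓ x ≈[ j ] B ↓ y
      above   : A ↑ x ≈[ j ] B ↑ y

  open Similar public

  Similar-sym : ∀ {x y} → Similar j A B x y → Similar j B A y x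
  Similar-sym (similar p q r) = similar (sym p) (≈-sym q) (≈-sym r)

  Similar-trans : ∀ {x y z} → Similar j A B x y → Similar j B C y z → Similar j A C x z
  Similar-trans (similar p q r) (similar p′ q′ r′) =
    similar (trans p p′) (q ⨾ q′) (r ⨾ r′)

  Similar⇒chr : ∀ {x y} → Similar j A B x y → chr j A x ≡ chr j B y
  Similar⇒chr {j = j} (similar p (mk≈ q) (mk≈ r)) =
    trans (cong (λ i → encode j i _ _) p) (cong₂ (encode j _) q r)

  chr⇒Similar : ∀ {x y} → chr j A x ≡ chr j B y → Similar j A B x y
  chr⇒Similar {j = j} eq =
    let p , q , r = encode-injective j eq in similar p (mk≈ q) (mk≈ r)

  realises : ∀ j (A : Lin d a) k →
             finToFun (tp (suc j) A) k ≡ truth (∃[ x ] chr j A x ≡ k)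
  realises j A = finToFun-funToFin (λ k → truth (∃[ x ] chr j A x ≡ k))

  forth : A ≈[ suc j ] B → ∀ x → ∃[ y ] Similar j A B x y
  forth {A = A} {j = j} {B = B} (mk≈ eq) x =
    let k = chr j A x
        y , p = truth-elim (trans (sym (realises j B k))
                  (trans (cong (λ t → finToFun t k) (sym eq))
                    (trans (realises j A k) (truth-yes (x , refl)))))
    in y , chr⇒Similar (sym p)

  back-and-forth : (∀ x → ∃[ y ] Similar j A B x y) →
                   (∀ y → ∃[ x ] Similar j B A y x) → A ≈[ suc j ] B
  back-and-forth {j = j} f g = mk≈ (funToFin-cong {m = #char j} λ k → truth-cong
    (λ { (x , refl) → let y , p = f x in y , sym (Similar⇒chr p) })
    (λ { (y , refl) → let x , p = g y in x , sym (Similar⇒chr p) }))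

  ≈-zero : A ≈[ 0 ] B
  ≈-zero = mk≈ refl

  ≅⇒≈ : A ≅ B → A ≈[ j ] B
  ≅⇒≈ {j = zero} f = ≈-zero
  ≅⇒≈ {A = A} {B = B} {j = suc j} f = back-and-forth
    (λ x → let y , r = F.to x in y , step r)
    (λ y → let x , r = F.from y in x , Similar-sym (step r))
    where
    module F = _≅_ f
    step : ∀ {x y} → x F.~ y → Similar j A B x y
    step r = similar (F.color-≡ r) (≅⇒≈ (↓-≅ f r)) (≅⇒≈ (↑-≅ f r))

  ≈-pred : A ≈[ suc j ] B → A ≈[ j ] B
  Similar-pred : ∀ {x y} → Similar (suc j) A B x y → Similar j A B x y
  ≈-pred {j = zero}  eq = ≈-zero
  ≈-pred {j = suc j} eq = back-and-forth
    (λ x → let y , p = forth eq x in y , Similar-pred p)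
    (λ y → let x , p = forth (≈-sym eq) y in x , Similar-pred p)
  Similar-pred (similar p q r) = similar p (≈-pred q) (≈-pred r)

  ≈-≤ : j ≤ k → A ≈[ k ] B → A ≈[ j ] B
  ≈-≤ j≤k eq = go (≤⇒≤′ j≤k) eq
    where
    go : j ≤′ k → A ≈[ k ] B → A ≈[ j ] B
    go (≤′-reflexive refl) eq = eq
    go (≤′-step p)         eq = go p (≈-pred eq)

  Similar-≤ : ∀ {x y} → j ≤ k → Similar k A B x y → Similar j A B x y
  Similar-≤ l (similar p q r) = similar p (≈-≤ l q) (≈-≤ l r)

  -- A move in one summand is answered in that summand; the other summand still has a round to
  -- spare.
  ⊕-cong : A ≈[ j ] A′ → B ≈[ j ] B′ → A ⊕ B ≈[ j ] A′ ⊕ B′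
  ⊕-cong {j = zero} p q = ≈-zero
  ⊕-cong {j = suc j} p q = back-and-forth (step p q) (step (≈-sym p) (≈-sym q))
    where
    step : ∀ {a a′ b b′} {A : Lin d a} {A′ : Lin d a′} {B : Lin d b} {B′ : Lin d b′} →
           A ≈[ suc j ] A′ → B ≈[ suc j ] B′ → ∀ x → ∃[ y ] Similar j (A ⊕ B) (A′ ⊕ B′) x y
    step p q (inj₁ x) =
      let y , s = forth p x
      in inj₁ y , similar (color-≡ s) (≅⇒≈ ⊕-↓ˡ ⨾ below s ⨾ ≈-sym (≅⇒≈ ⊕-↓ˡ))
           (≅⇒≈ ⊕-↑ˡ ⨾ ⊕-cong (above s) (≈-pred q) ⨾ ≈-sym (≅⇒≈ ⊕-↑ˡ))
    step p q (inj₂ x) =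
      let y , s = forth q x
      in inj₂ y , similar (color-≡ s)
           (≅⇒≈ ⊕-↓ʳ ⨾ ⊕-cong (≈-pred p) (below s) ⨾ ≈-sym (≅⇒≈ ⊕-↓ʳ))
           (≅⇒≈ ⊕-↑ʳ ⨾ above s ⨾ ≈-sym (≅⇒≈ ⊕-↑ʳ))

  point-cong : ∀ {i i′} → i ≡ i′ → point i ≈[ j ] point i′
  point-cong refl = ≈-refl

  module _ (A : Lin d a) (y : Pt A) where
    private module A = Lin A

    data Side : Pt A → Pt (A ↓ y ⊕ point (color A y) ⊕ A ↑ y) → Set a where
      lower : ∀ {x p} → Side x (inj₁ (x , p))
      equal : ∀ {x} → ¬ x A.< y → ¬ y A.< x → Side x (inj₂ (inj₁ tt))
      upper : ∀ {x p} → Side x (inj₂ (inj₂ (x , p)))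

    which-side : ∀ x → ∃[ z ] Side x z
    which-side x with em {P = x A.< y} | em {P = y A.< x}
    ... | yes p | _     = _ , lower {p = p}
    ... | no _  | yes p = _ , upper {p = p}
    ... | no p  | no q  = _ , equal p q

    split-≅ : A ≅ A ↓ y ⊕ point (color A y) ⊕ A ↑ y
    split-≅ = record
      { _~_     = Side
      ; to      = which-side
      ; from    = λ { (inj₁ _) → _ , lower
                    ; (inj₂ (inj₁ _)) → y , equal A.irrefl A.irrefl
                    ; (inj₂ (inj₂ _)) → _ , upper }
      ; color-≡ = λ { lower → refl ; (equal p q) → A.color-resp p q ; upper → refl }
      ; to-<    = to-<
      ; from-<  = from-<
      }
      where
      to-< : ∀ {x x′ z z′} → Side x z → Side x′ z′ → x A.< x′ →
             (A ↓ y ⊕ point (color A y) ⊕ A ↑ y) ∋ z < z′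
      to-< lower lower p = Level.lift p
      to-< lower (equal _ _) p = tt
      to-< lower upper p = tt
      to-< (equal q _) (lower {p = r}) p = contradiction (A.<-trans p r) q
      to-< (equal q _) (equal _ q′) p with A.cotrans y p
      ... | inj₁ r = contradiction r q
      ... | inj₂ r = contradiction r q′
      to-< (equal _ _) upper p = Level.lift tt
      to-< (upper {p = q}) (lower {p = r}) p =
        contradiction (A.<-trans q p) (A.asym r)
      to-< (upper {p = q}) (equal _ r) p = contradiction (A.<-trans q p) r
      to-< upper upper p = Level.lift (Level.lift p)

      from-< : ∀ {x x′ z z′} → Side x z → Side x′ z′ →
               (A ↓ y ⊕ point (color A y) ⊕ A ↑ y) ∋ z < z′ → x A.< x′
      from-< lower lower (Level.lift p) = p
      from-< (lower {p = p}) (equal q _) _ = A.<-≤-trans p q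
      from-< (lower {p = p}) (upper {p = q}) _ = A.<-trans p q
      from-< (equal _ _) lower (Level.lift ())
      from-< (equal _ _) (equal _ _) (Level.lift ())
      from-< (equal _ q) (upper {p = p}) _ = A.≤-<-trans q p
      from-< upper lower (Level.lift ())
      from-< upper (equal _ _) (Level.lift (Level.lift ()))
      from-< upper upper (Level.lift (Level.lift p)) = p

-- Intervals in context, their depth, and the back-and-forth argument.

record Part (d : ℕ) (a : Level) : Set (lsuc a) where
  field
    whole   : Lin d a
    Lo Hi   : Pred (Pt whole) a
    Lo-up   : ∀ {x y} → Lo x → ¬ whole ∋ y < x → Lo y
    Hi-down : ∀ {x y} → Hi x → ¬ whole ∋ x < y → Hi y

  open Lin whole public

  In : Pred (Pt whole) a
  In x = Lo x × Hi x

  -- `nothing` stands for the end of the interval itself, which is a cut and need not be a point of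
  -- `whole`.
  low high : Maybe (Pt whole) → Pred (Pt whole) a
  low nothing   = Lo
  low (just c)  = c <_
  high nothing  = Hi
  high (just c) = _< c

  segment : (b e : Maybe (Pt whole)) → Lin d a
  segment b e = whole ∣ (λ x → low b x × high e x)

  before after : Maybe (Pt whole) → Lin d a
  before b = whole ∣ (λ x → ¬ low b x)
  after  e = whole ∣ (λ x → ¬ high e x)

module Intervals
  (em : ∀ {ℓ : Level} → ExcludedMiddle ℓ) (d : ℕ)
  where

  open Types em d

  module PartProperties (P : Part d a) where
    open Part P

    low-up : ∀ b {x y} → low b x → x < y → low b y
    low-up nothing  p q = Lo-up p (asym q)
    low-up (just c) p q = <-trans p q

    high-down : ∀ e {x y} → high e y → x < y → high e x
    high-down nothing  p q = Hi-down p (asym q)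
    high-down (just c) p q = <-trans q p

    low-cut : ∀ b {x y} → ¬ low b x → low b y → x < y
    low-cut b {x} {y} p q with em {P = x < y}
    low-cut b        p q | yes r = r
    low-cut nothing  p q | no r = contradiction (Lo-up q r) p
    low-cut (just c) p q | no r = ≤-<-trans p q

    high-cut : ∀ e {x y} → high e x → ¬ high e y → x < y
    high-cut e {x} {y} p q with em {P = x < y}
    high-cut e        p q | yes r = r
    high-cut nothing  p q | no r = contradiction (Hi-down p r) q
    high-cut (just c) p q | no r = <-≤-trans p q

    segment-↓ : ∀ b e {w} (p : low b w × high e w) → segment b e ↓ (w , p) ≅ segment b (just w)
    segment-↓ b e p = ∣-∣-≅ (λ { (q , _) r → q , r })
                            (λ { (q , r) → (q , high-down e (proj₂ p) r) , r })

    segment-↑ : ∀ b e {w} (p : low b w × high e w) → segment b e ↑ (w , p) ≅ segment (just w) e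
    segment-↑ b e p = ∣-∣-≅ (λ { (_ , q) r → r , q })
                            (λ { (r , q) → (low-up b (proj₁ p) r , q) , r })

    ↓-split : ∀ b {w} → low b w → whole ↓ w ≅ before b ⊕ segment b (just w)
    ↓-split b p = cut-≅ (λ {x} q → side (em {P = low b x}) q) (λ q → low-cut b q p) proj₂
                        (λ q r → low-cut b q (proj₁ r))
      where
      side : ∀ {x w} → Dec (low b x) → x < w → ¬ low b x ⊎ low b x × x < w
      side (yes q) r = inj₂ (q , r)
      side (no q)  r = inj₁ q

    ↑-split : ∀ e {w} → high e w → whole ↑ w ≅ segment (just w) e ⊕ after e
    ↑-split e p = cut-≅ (λ {x} q → side (em {P = high e x}) q) proj₁ (λ q → high-cut e p q)
                        (λ q r → high-cut e (proj₂ q) r)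
      where
      side : ∀ {x w} → Dec (high e x) → w < x → (w < x × high e x) ⊎ ¬ high e x
      side (yes q) r = inj₁ (r , q)
      side (no q)  r = inj₂ q

    before-≈ : ∀ {j} c → before (just c) ≈[ j ] whole ↓ c ⊕ point (Lin.color whole c)
    before-≈ c = ≅⇒≈ (split-≅ (before (just c)) (c , irrefl))
      ⨾ ⊕-cong (≅⇒≈ (∣-∣-≅ (λ _ q → q) (λ q → asym q , q)))
               (⊕-cong ≈-refl (≅⇒≈ (empty-≅ (λ { ((_ , p) , q) → p q }) Level.lower))
                ⨾ ≅⇒≈ (⊕-identityʳ {b = 0ℓ}))

    after-≈ : ∀ {j} c → after (just c) ≈[ j ] point (Lin.color whole c) ⊕ whole ↑ c
    after-≈ c = ≅⇒≈ (split-≅ (after (just c)) (c , irrefl))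
      ⨾ ⊕-cong (≅⇒≈ (empty-≅ (λ { ((_ , p) , q) → p q }) Level.lower))
               (⊕-cong ≈-refl (≅⇒≈ (∣-∣-≅ (λ _ q → q) (λ q → asym q , q))))
      ⨾ ≅⇒≈ (⊕-identityˡ {a = 0ℓ})

  -- `N` will be `H ⊕ I ⊕ R` and `ι` the inclusion of `I`, so that `I` and its replacement are
  -- measured against the same characters.
  module Reference (N : Lin d ℓ) {Idx : Set ℓ′} (ι : Idx → Pt N) where

    module _ (P : Part d a) where
      open Part P
      open PartProperties P

      -- The characters that have to recur are those of the points ι k of N.

      Deep : ℕ → (b e : Maybe (Pt whole)) → Set (a ⊔ ℓ′)
      Deep zero    b e = ⊤
      Deep (suc l) b e = ∀ k → ∃[ w ] (low b w × high e w) × Similar l whole N w (ι k) ×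
                                      Deep l b (just w) × Deep l (just w) e

      Deep-mono : ∀ l {b b′ e e′} → (∀ {x} → low b x → low b′ x) →
                  (∀ {x} → high e x → high e′ x) → Deep l b e → Deep l b′ e′
      Deep-mono zero    f g D = tt
      Deep-mono (suc l) f g D k =
        let w , (p , q) , s , D₁ , D₂ = D k
        in w , (f p , g q) , s , Deep-mono l f id D₁ , Deep-mono l id g D₂

      Deep-pred : ∀ l {b e} → Deep (suc l) b e → Deep l b e
      Deep-pred zero    D = tt
      Deep-pred (suc l) D k =
        let w , p , s , D₁ , D₂ = D k
        in w , p , Similar-pred s , Deep-pred l D₁ , Deep-pred l D₂

      Deep-≤ : ∀ {l m b e} → l ≤ m → Deep m b e → Deep l b e
      Deep-≤ {l} l≤m = go (≤⇒≤′ l≤m)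
        where
        go : ∀ {m b e} → l ≤′ m → Deep m b e → Deep l b e
        go (≤′-reflexive refl) D = D
        go (≤′-step p)         D = go p (Deep-pred _ D)

      -- A witness `w` of depth has a deep interval on either side, and `z` cannot cut into both of
      -- them.
      Deep-split : ∀ l {b e} → Idx → Deep (suc l) b e → ∀ z →
                   Deep l b (just z) ⊎ Deep l (just z) e
      Deep-split l k D z with D k
      ... | w , _ , _ , D₁ , D₂ with em {P = w < z}
      ...   | yes p = inj₁ (Deep-mono l id (λ q → <-trans q p) D₁)
      ...   | no p  = inj₂ (Deep-mono l (λ q → ≤-<-trans p q) id D₂)

      -- Recurrence is demanded upwards only, since a nonempty well-order has a least point. This
      -- asymmetry is why the two ends are treated differently below.
      record Recurrent (j : ℕ) : Set (a ⊔ ℓ′) where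
        field
          refers    : ∀ {x} → In x → ∃[ k ] Similar j whole N x (ι k)
          cofinal   : ∀ k {c} → In c → ∃[ x ] (c < x × In x) × Similar j whole N x (ι k)
          inhabited : ∃[ x ] In x

      module RecurrentProperties {j : ℕ} (R : Recurrent j) where
        open Recurrent R

        index : Idx
        index = proj₁ (refers (proj₂ inhabited))

        -- Witnesses are collected one after the other, each beyond the previous end. Running over
        -- the finitely many codes in `Char l` makes this stop even if `Idx` is infinite. Depth
        -- `suc j` is attainable because its witnesses are only compared at rank `j`.
        reach : ∀ l → l ≤ suc j → ∀ {c} → In c →
                ∃[ e ] (c < e × In e) × Deep l (just c) (just e)
        reach zero    l≤ p = let e , q , _ = cofinal index p in e , q , tt
        reach (suc l) (s≤s l≤) {c} p with reach l (m≤n⇒m≤1+n l≤) p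
        ... | e₀ , (c<e₀ , p₀) , D₀ =
          let e , q , _ , f = collect (allFin _) in e , q , λ k → f k (∈-allFin _)
          where
          Collected : Pt whole → Idx → Set _
          Collected e k = ∃[ w ] (c < w × w < e) × Similar l whole N w (ι k) ×
                          Deep l (just c) (just w) × Deep l (just w) (just e)

          -- The end never drops below `e₀`, so each new witness has the deep interval from `c` to
          -- `e₀` on its left; a further call of `reach` provides the one on its right.
          collect : (ks : List (Char l)) → ∃[ e ] (c < e × In e) × ¬ e < e₀ ×
                    (∀ k → chr l N (ι k) ∈ ks → Collected e k)
          collect [] = e₀ , (c<e₀ , p₀) , irrefl , λ _ ()
          collect (k ∷ ks) with collect ks | em {P = ∃[ k′ ] chr l N (ι k′) ≡ k}
          ... | e , q , r , f | no ¬k = e , q , r , λ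
            { k′ (here eq) → contradiction (k′ , eq) ¬k ; k′ (there m) → f k′ m }
          ... | e , (c<e , q) , r , f | yes (k₀ , eq₀) =
            let w , (e<w , q′) , s     = cofinal k₀ q
                e′ , (w<e′ , q″) , D   = reach l (m≤n⇒m≤1+n l≤) q′
                e₀<w = ≤-<-trans r e<w
                e<e′ = <-trans e<w w<e′
            in e′ , (<-trans c<e e<e′ , q″) , (λ p → r (<-trans e<e′ p)) , λ
              { k′ (here eq) → w , (<-trans c<e e<w , w<e′) ,
                  Similar-trans (Similar-≤ l≤ s) (chr⇒Similar (trans eq₀ (sym eq))) ,
                  Deep-mono l id (λ x → <-trans x e₀<w) D₀ , D
              ; k′ (there m) → let v , (c<v , v<e) , s′ , D₁ , D₂ = f k′ m in
                  v , (c<v , <-trans v<e e<e′) , s′ , D₁ ,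
                  Deep-mono l id (λ x → <-trans x e<e′) D₂ }

        -- Consequently no point is shallow from an open right end, and `high-forth` has no reply to
        -- find there.
        Deep-end : ∀ {l} → l ≤ suc j → ∀ {c} → In c → Deep l (just c) nothing
        Deep-end {l} l≤ p =
          let e , (_ , q) , D = reach l l≤ p
          in Deep-mono l id (λ r → Hi-down (proj₂ q) (asym r)) D

    module Transfer {a a′} (P : Part d a) (P′ : Part d a′) where
      private
        module P  = Part P
        module P′ = Part P′
        module PP  = PartProperties P
        module PP′ = PartProperties P′

      ↓-≈ : ∀ {l} b b′ {w w′} → P.low b w → P′.low b′ w′ → P.before b ≈[ l ] P′.before b′ →
            P.segment b (just w) ≈[ l ] P′.segment b′ (just w′) → P.whole ↓ w ≈[ l ] P′.whole ↓ w′
      ↓-≈ b b′ p p′ q s = ≅⇒≈ (PP.↓-split b p) ⨾ ⊕-cong q s ⨾ ≈-sym (≅⇒≈ (PP′.↓-split b′ p′))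

      ↑-≈ : ∀ {l} e e′ {w w′} → P.high e w → P′.high e′ w′ → P.after e ≈[ l ] P′.after e′ →
            P.segment (just w) e ≈[ l ] P′.segment (just w′) e′ → P.whole ↑ w ≈[ l ] P′.whole ↑ w′
      ↑-≈ e e′ p p′ q s = ≅⇒≈ (PP.↑-split e p) ⨾ ⊕-cong s q ⨾ ≈-sym (≅⇒≈ (PP′.↑-split e′ p′))

      before-cong : ∀ {l c c′} → P.color c ≡ P′.color c′ → P.whole ↓ c ≈[ l ] P′.whole ↓ c′ →
                    P.before (just c) ≈[ l ] P′.before (just c′)
      before-cong p q = PP.before-≈ _ ⨾ ⊕-cong q (point-cong p) ⨾ ≈-sym (PP′.before-≈ _)

      after-cong : ∀ {l c c′} → P.color c ≡ P′.color c′ → P.whole ↑ c ≈[ l ] P′.whole ↑ c′ →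
                   P.after (just c) ≈[ l ] P′.after (just c′)
      after-cong p q = PP.after-≈ _ ⨾ ⊕-cong (point-cong p) q ⨾ ≈-sym (PP′.after-≈ _)

      segment-forth : ∀ {l} b e b′ e′ → P.segment b e ≈[ suc l ] P′.segment b′ e′ →
        ∀ {w} → P.low b w → P.high e w →
        ∃[ w′ ] (P′.low b′ w′ × P′.high e′ w′) × P.color w ≡ P′.color w′ ×
                P.segment b (just w) ≈[ l ] P′.segment b′ (just w′) ×
                P.segment (just w) e ≈[ l ] P′.segment (just w′) e′
      segment-forth b e b′ e′ q p₁ p₂ =
        let (w′ , p′) , s = forth q (_ , p₁ , p₂)
        in w′ , p′ , color-≡ s ,
           (≈-sym (≅⇒≈ (PP.segment-↓ b e (p₁ , p₂))) ⨾ below s ⨾ ≅⇒≈ (PP′.segment-↓ b′ e′ p′)) ,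
           (≈-sym (≅⇒≈ (PP.segment-↑ b e (p₁ , p₂))) ⨾ above s ⨾ ≅⇒≈ (PP′.segment-↑ b′ e′ p′))

      -- The game follows a witness of depth with one round. The witness must be similar in the
      -- whole order, but only at one rank less, and this is assembled from the two halves of the
      -- segment and the outer pieces; hence `pred l` for the latter.
      Deep-transfer : ∀ l {b e b′ e′} →
                      P.before b ≈[ pred l ] P′.before b′ → P.after e ≈[ pred l ] P′.after e′ →
                      P.segment b e ≈[ l ] P′.segment b′ e′ → Deep P l b e → Deep P′ l b′ e′
      Deep-transfer zero    q r s D = tt
      Deep-transfer (suc l) {b} {e} {b′} {e′} q r s D k =
        let w , (p₁ , p₂) , t , D₁ , D₂       = D k
            w′ , (p₁′ , p₂′) , c , s₁ , s₂    = segment-forth b e b′ e′ s p₁ p₂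
            t↓ = ↓-≈ b b′ p₁ p₁′ q s₁
            t↑ = ↑-≈ e e′ p₂ p₂′ r s₂
        in w′ , (p₁′ , p₂′) , Similar-trans (similar (sym c) (≈-sym t↓) (≈-sym t↑)) t ,
           Deep-transfer l {b} {just w} {b′} {just w′} (≈-≤ pred≤ q) (≈-≤ pred≤ (after-cong c t↑)) s₁ D₁ ,
           Deep-transfer l {just w} {e} {just w′} {e′} (≈-≤ pred≤ (before-cong c t↓)) (≈-≤ pred≤ r) s₂ D₂
        where
        pred≤ : pred l ≤ l
        pred≤ = pred[n]≤n

      -- The side of `c` that faces the interval carries an extra rank. It pays for one local reply
      -- near this end.
      data LowMatch (l : ℕ) : Maybe P.Pt → Maybe P′.Pt → Set (a ⊔ a′) where
        start : LowMatch l nothing nothing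
        at    : ∀ {c c′} → P.color c ≡ P′.color c′ → P.whole ↓ c ≈[ l ] P′.whole ↓ c′ →
                P.whole ↑ c ≈[ suc l ] P′.whole ↑ c′ → LowMatch l (just c) (just c′)

      data HighMatch (l : ℕ) : Maybe P.Pt → Maybe P′.Pt → Set (a ⊔ a′) where
        end : HighMatch l nothing nothing
        at  : ∀ {c c′} → P.color c ≡ P′.color c′ → P.whole ↓ c ≈[ suc l ] P′.whole ↓ c′ →
              P.whole ↑ c ≈[ l ] P′.whole ↑ c′ → HighMatch l (just c) (just c′)

      LowMatch-pred : ∀ {l b b′} → LowMatch (suc l) b b′ → LowMatch l b b′
      LowMatch-pred start      = start
      LowMatch-pred (at p q r) = at p (≈-pred q) (≈-pred r)

      HighMatch-pred : ∀ {l b b′} → HighMatch (suc l) b b′ → HighMatch l b b′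
      HighMatch-pred end        = end
      HighMatch-pred (at p q r) = at p (≈-pred q) (≈-pred r)

      -- At an open left end there is no point from which a local reply could be played. `prefix`
      -- takes its place: a point that is shallow from there has a ready-made partner with an
      -- equivalent initial segment.
      record Compatible (j : ℕ) : Set (a ⊔ a′ ⊔ ℓ′) where
        field
          before≈ : P.before nothing ≈[ j ] P′.before nothing
          after≈  : P.after nothing ≈[ j ] P′.after nothing
          prefix  : ∀ {x} → P.In x → Deep P (suc j) nothing (just x) ⊎
                    ∃[ x′ ] P′.In x′ × Similar j P.whole P′.whole x x′ ×
                            P.segment nothing (just x) ≈[ j ] P′.segment nothing (just x′)

      -- Each round costs one rank and one level of depth: a segment divided by a move keeps depth
      -- one lower on the side that is treated by induction.
      Alike : ℕ → Set _
      Alike l = ∀ {b e b′ e′} → LowMatch l b b′ → HighMatch l e e′ →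
                Deep P (suc l) b e → Deep P′ (suc l) b′ e′ →
                (∀ {x} → P.low b x → P.high e x → P.In x) →
                (∀ {x} → P′.low b′ x → P′.high e′ x → P′.In x) →
                P.segment b e ≈[ l ] P′.segment b′ e′

      LowMatch⇒≈ : ∀ {j l b b′} → Compatible j → l ≤ j → LowMatch l b b′ →
                   P.before b ≈[ l ] P′.before b′
      LowMatch⇒≈ C l≤ start      = ≈-≤ l≤ (Compatible.before≈ C)
      LowMatch⇒≈ C l≤ (at p q _) = before-cong p q

      HighMatch⇒≈ : ∀ {j l e e′} → Compatible j → l ≤ j → HighMatch l e e′ →
                    P.after e ≈[ l ] P′.after e′
      HighMatch⇒≈ C l≤ end        = ≈-≤ l≤ (Compatible.after≈ C)
      HighMatch⇒≈ C l≤ (at p _ q) = after-cong p q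

      low-forth : ∀ {j l b b′ w} → Compatible j → l ≤ j → LowMatch l b b′ →
                  P.low b w → P.In w → ¬ Deep P l b (just w) →
                  ∃[ w′ ] P′.low b′ w′ × Similar l P.whole P′.whole w w′ ×
                          P.segment b (just w) ≈[ l ] P′.segment b′ (just w′)
      low-forth C l≤ start p q ¬D with Compatible.prefix C q
      ... | inj₁ D = contradiction (Deep-≤ P (m≤n⇒m≤1+n l≤) D) ¬D
      ... | inj₂ (w′ , q′ , s , t) = w′ , proj₁ q′ , Similar-≤ l≤ s , ≈-≤ l≤ t
      low-forth {b = b} {b′} C l≤ (at {c} {c′} i q r) p _ _ =
        let (w′ , p′) , s = forth r (_ , p)
            t = ≈-sym (≅⇒≈ (∣-∣-≅ (λ x y → x , y) (λ x → x)))
                ⨾ below s ⨾ ≅⇒≈ (∣-∣-≅ (λ x y → x , y) (λ x → x))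
        in w′ , p′ ,
           similar (color-≡ s) (↓-≈ b b′ p p′ (LowMatch⇒≈ C l≤ (at i q r)) t)
             (≈-sym (≅⇒≈ (∣-∣-≅ (λ _ x → x) (λ x → P.<-trans p x , x)))
              ⨾ above s ⨾ ≅⇒≈ (∣-∣-≅ (λ _ x → x) (λ x → P′.<-trans p′ x , x))) ,
           t

      high-forth : ∀ {j l e e′ w} → Compatible j → Recurrent P j → l ≤ j → HighMatch l e e′ →
                   P.high e w → P.In w → ¬ Deep P l (just w) e →
                   ∃[ w′ ] P′.high e′ w′ × Similar l P.whole P′.whole w w′ ×
                           P.segment (just w) e ≈[ l ] P′.segment (just w′) e′
      high-forth C R l≤ end p q ¬D =
        contradiction (RecurrentProperties.Deep-end P R (m≤n⇒m≤1+n l≤) q) ¬D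
      high-forth {e = e} {e′} C R l≤ (at {c} {c′} i q r) p _ _ =
        let (w′ , p′) , s = forth q (_ , p)
            t = ≈-sym (≅⇒≈ (∣-∣-≅ (λ x y → y , x) (λ { (x , y) → y , x })))
                ⨾ above s ⨾ ≅⇒≈ (∣-∣-≅ (λ x y → y , x) (λ { (x , y) → y , x }))
        in w′ , p′ ,
           similar (color-≡ s)
             (≈-sym (≅⇒≈ (∣-∣-≅ (λ _ x → x) (λ x → P.<-trans x p , x)))
              ⨾ below s ⨾ ≅⇒≈ (∣-∣-≅ (λ _ x → x) (λ x → P′.<-trans x p′ , x)))
             (↑-≈ e e′ p p′ (HighMatch⇒≈ C l≤ (at i q r)) t) ,
           t

    module _ {a a′} (P : Part d a) (P′ : Part d a′) where
      private
        module P  = Part P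
        module P′ = Part P′
        module PP  = PartProperties P
        module PP′ = PartProperties P′
        module T  = Transfer P P′
        module T′ = Transfer P′ P

      private
        other : {A B : Set c} → A ⊎ B → ¬ A → B
        other (inj₁ x) ¬x = contradiction x ¬x
        other (inj₂ y) _  = y

      -- A reply to w: if w is shallow from either end it is given by the match of
      -- that end, otherwise any point of the same character that is deep from both ends will do.

      Alike-forth : ∀ {j l} → T.Compatible j → Recurrent P j → Recurrent P′ j → suc l ≤ j →
        T.Alike l → ∀ {b e b′ e′} →
        T.LowMatch (suc l) b b′ → T.HighMatch (suc l) e e′ →
        Deep P (suc (suc l)) b e → Deep P′ (suc (suc l)) b′ e′ →
        (∀ {x} → P.low b x → P.high e x → P.In x) →
        (∀ {x} → P′.low b′ x → P′.high e′ x → P′.In x) →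
        ∀ x → ∃[ y ] Similar l (P.segment b e) (P′.segment b′ e′) x y
      Alike-forth {j} {l} C R R′ l<j alike {b} {e} {b′} {e′} L H D D′ I I′ (w , p₁ , p₂) =
        reply (em {P = Deep P (suc l) b (just w)}) (em {P = Deep P (suc l) (just w) e})
        where
        ind : Idx
        ind = RecurrentProperties.index P R

        answer : ∀ {w′} → P′.low b′ w′ → P′.high e′ w′ → Similar (suc l) P.whole P′.whole w w′ →
                 P.segment b (just w) ≈[ l ] P′.segment b′ (just w′) →
                 P.segment (just w) e ≈[ l ] P′.segment (just w′) e′ →
                 ∃[ y ] Similar l (P.segment b e) (P′.segment b′ e′) (w , p₁ , p₂) y
        answer p₁′ p₂′ s t↓ t↑ = (_ , p₁′ , p₂′) , similar (color-≡ s)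
          (≅⇒≈ (PP.segment-↓ b e (p₁ , p₂)) ⨾ t↓ ⨾ ≈-sym (≅⇒≈ (PP′.segment-↓ b′ e′ (p₁′ , p₂′))))
          (≅⇒≈ (PP.segment-↑ b e (p₁ , p₂)) ⨾ t↑ ⨾ ≈-sym (≅⇒≈ (PP′.segment-↑ b′ e′ (p₁′ , p₂′))))

        lowMatch : ∀ {w′} → Similar (suc l) P.whole P′.whole w w′ → T.LowMatch l (just w) (just w′)
        lowMatch s = T.at (color-≡ s) (≈-pred (below s)) (above s)

        highMatch : ∀ {w′} → Similar (suc l) P.whole P′.whole w w′ → T.HighMatch l (just w) (just w′)
        highMatch s = T.at (color-≡ s) (below s) (≈-pred (above s))

        alike↓ : ∀ {w′} → P′.high e′ w′ → Similar (suc l) P.whole P′.whole w w′ →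
                 Deep P (suc l) b (just w) → Deep P′ (suc l) b′ (just w′) →
                 P.segment b (just w) ≈[ l ] P′.segment b′ (just w′)
        alike↓ p′ s D₁ D₁′ = alike (T.LowMatch-pred L) (highMatch s) D₁ D₁′
          (λ x y → I x (PP.high-down e p₂ y)) (λ x y → I′ x (PP′.high-down e′ p′ y))

        alike↑ : ∀ {w′} → P′.low b′ w′ → Similar (suc l) P.whole P′.whole w w′ →
                 Deep P (suc l) (just w) e → Deep P′ (suc l) (just w′) e′ →
                 P.segment (just w) e ≈[ l ] P′.segment (just w′) e′
        alike↑ p′ s D₁ D₁′ = alike (lowMatch s) (T.HighMatch-pred H) D₁ D₁′
          (λ x y → I (PP.low-up b p₁ x) y) (λ x y → I′ (PP′.low-up b′ p′ x) y)

        reply : Dec (Deep P (suc l) b (just w)) → Dec (Deep P (suc l) (just w) e) →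
                ∃[ y ] Similar l (P.segment b e) (P′.segment b′ e′) (w , p₁ , p₂) y
        -- `low-forth` ignores the right end. Shallowness passes from `w` to `w′`; were `w′` not
        -- below `e′`, the depth of the whole primed segment would contradict it. By `Deep-split`
        -- the parts to the right of `w` and `w′` are deep, and the induction hypothesis compares
        -- them.
        reply (no ¬D) _ =
          let w′ , p₁′ , s , t = T.low-forth C l<j L p₁ (I p₁ p₂) ¬D
              ¬D′ : ¬ Deep P′ (suc l) b′ (just w′)
              ¬D′ = λ D₁ → ¬D (T′.Deep-transfer (suc l) {b′} {just w′} {b} {just w}
                      (≈-pred (≈-sym (T.LowMatch⇒≈ C l<j L)))
                      (≈-pred (≈-sym (T.after-cong (color-≡ s) (above s)))) (≈-sym t) D₁)
              p₂′ : P′.high e′ w′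
              p₂′ = high′ ¬D′
          in answer p₁′ p₂′ s (≈-pred t)
               (alike↑ p₁′ s (other (Deep-split P (suc l) ind D w) ¬D)
                             (other (Deep-split P′ (suc l) ind D′ w′) ¬D′))
          where
          high′ : ∀ {w′} → ¬ Deep P′ (suc l) b′ (just w′) → P′.high e′ w′
          high′ {w′} ¬D′ with em {P = P′.high e′ w′}
          ... | yes p = p
          ... | no ¬p = contradiction
            (Deep-mono P′ (suc l) id (λ q → PP′.high-cut e′ q ¬p) (Deep-pred P′ (suc l) D′)) ¬D′
        reply (yes _) (no ¬D) =
          let w′ , p₂′ , s , t = T.high-forth C R l<j H p₂ (I p₁ p₂) ¬D
              ¬D′ : ¬ Deep P′ (suc l) (just w′) e′
              ¬D′ = λ D₁ → ¬D (T′.Deep-transfer (suc l) {just w′} {e′} {just w} {e}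
                      (≈-pred (≈-sym (T.before-cong (color-≡ s) (below s))))
                      (≈-pred (≈-sym (T.HighMatch⇒≈ C l<j H))) (≈-sym t) D₁)
              p₁′ : P′.low b′ w′
              p₁′ = low′ ¬D′
          in answer p₁′ p₂′ s
               (alike↓ p₂′ s (other (swap (Deep-split P (suc l) ind D w)) ¬D)
                             (other (swap (Deep-split P′ (suc l) ind D′ w′)) ¬D′))
               (≈-pred t)
          where
          low′ : ∀ {w′} → ¬ Deep P′ (suc l) (just w′) e′ → P′.low b′ w′
          low′ {w′} ¬D′ with em {P = P′.low b′ w′}
          ... | yes p = p
          ... | no ¬p = contradiction
            (Deep-mono P′ (suc l) (λ q → PP′.low-cut b′ ¬p q) id (Deep-pred P′ (suc l) D′)) ¬D′
        reply (yes D₁) (yes D₂) =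
          let k , s = Recurrent.refers R (I p₁ p₂)
              w′ , (p₁′ , p₂′) , s′ , D₁′ , D₂′ = D′ k
              t = Similar-trans (Similar-≤ l<j s) (Similar-sym s′)
          in answer p₁′ p₂′ t (alike↓ p₂′ t D₁ D₁′) (alike↑ p₁′ t D₂ D₂′)

    module _ {a a′} (P : Part d a) (P′ : Part d a′) where
      private
        module P  = Part P
        module P′ = Part P′
        module T  = Transfer P P′
        module T′ = Transfer P′ P

      LowMatch-sym : ∀ {l b b′} → T.LowMatch l b b′ → T′.LowMatch l b′ b
      LowMatch-sym T.start      = T′.start
      LowMatch-sym (T.at p q r) = T′.at (sym p) (≈-sym q) (≈-sym r)

      HighMatch-sym : ∀ {l b b′} → T.HighMatch l b b′ → T′.HighMatch l b′ b
      HighMatch-sym T.end        = T′.end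
      HighMatch-sym (T.at p q r) = T′.at (sym p) (≈-sym q) (≈-sym r)

    alike : ∀ {a a′} (P : Part d a) (P′ : Part d a′) {j} →
            Transfer.Compatible P P′ j → Transfer.Compatible P′ P j →
            Recurrent P j → Recurrent P′ j → ∀ {l} → l ≤ j → Transfer.Alike P P′ l
    alike P P′ C C′ R R′ {zero}  l≤ L H D D′ I I′ = ≈-zero
    alike P P′ C C′ R R′ {suc l} l≤ L H D D′ I I′ = back-and-forth
      (Alike-forth P P′ C R R′ l≤ (alike P P′ C C′ R R′ l≤′) L H D D′
        (λ x y → I x y) (λ x y → I′ x y))
      (Alike-forth P′ P C′ R′ R l≤ (alike P′ P C′ C R′ R l≤′)
        (LowMatch-sym P P′ L) (HighMatch-sym P P′ H) D′ D
        (λ x y → I′ x y) (λ x y → I x y))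
      where l≤′ = ≤-trans (n≤1+n l) l≤

-- Sums of finitely many copies, and of ω copies, of an order.

module _ (G : Lin d g) where
  private module G = Lin G

  private
    _⊏_ : ℕ × G.Pt → ℕ × G.Pt → Set g
    (m , x) ⊏ (n , y) = m ℕ.< n ⊎ (m ≡ n × x G.< y)

    ⊏-cotrans : ∀ {u v} w → u ⊏ v → u ⊏ w ⊎ w ⊏ v
    ⊏-cotrans {m , _} {n , _} (k , _) _ with ℕ.<-cmp m k | ℕ.<-cmp k n
    ⊏-cotrans _ _ | tri< p _ _ | _ = inj₁ (inj₁ p)
    ⊏-cotrans _ _ | _ | tri< p _ _ = inj₂ (inj₁ p)
    ⊏-cotrans w (inj₁ p) | tri≈ _ refl _ | tri≈ _ refl _ = contradiction p (ℕ.<-irrefl refl)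
    ⊏-cotrans (_ , z) (inj₂ (refl , p)) | tri≈ _ refl _ | tri≈ _ refl _ with G.cotrans z p
    ... | inj₁ q = inj₁ (inj₂ (refl , q))
    ... | inj₂ q = inj₂ (inj₂ (refl , q))
    ⊏-cotrans w (inj₁ p) | tri≈ _ refl _ | tri> _ _ q = contradiction p (ℕ.<-asym q)
    ⊏-cotrans w (inj₂ (refl , _)) | tri≈ _ refl _ | tri> _ _ q = contradiction q (ℕ.<-irrefl refl)
    ⊏-cotrans w (inj₁ p) | tri> _ _ q | tri≈ _ refl _ = contradiction p (ℕ.<-asym q)
    ⊏-cotrans w (inj₂ (refl , _)) | tri> _ _ q | tri≈ _ refl _ = contradiction q (ℕ.<-irrefl refl)
    ⊏-cotrans w (inj₁ p) | tri> _ _ q | tri> _ _ q′ = contradiction p (ℕ.<-asym (ℕ.<-trans q′ q))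
    ⊏-cotrans w (inj₂ (refl , _)) | tri> _ _ q | tri> _ _ q′ = contradiction q (ℕ.<-asym q′)

  ω-power : Lin d g
  ω-power = record
    { Pt         = ℕ × G.Pt
    ; _<_        = _⊏_
    ; color      = G.color ∘ proj₂
    ; asym       = λ { (inj₁ p) (inj₁ q) → ℕ.<-asym p q
                     ; (inj₁ p) (inj₂ (refl , _)) → ℕ.<-irrefl refl p
                     ; (inj₂ (refl , _)) (inj₁ p) → ℕ.<-irrefl refl p
                     ; (inj₂ (refl , p)) (inj₂ (_ , q)) → G.asym p q }
    ; cotrans    = ⊏-cotrans
    ; color-resp = λ {u} {v} → resp u v
    }
    where
    resp : ∀ u v → ¬ u ⊏ v → ¬ v ⊏ u → G.color (proj₂ u) ≡ G.color (proj₂ v)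
    resp (m , _) (n , _) p q with ℕ.<-cmp m n
    ... | tri< r _ _    = contradiction (inj₁ r) p
    ... | tri≈ _ refl _ = G.color-resp (λ r → p (inj₂ (refl , r))) (λ r → q (inj₂ (refl , r)))
    ... | tri> _ _ r    = contradiction (inj₁ r) q

  data Unfold : Pt ω-power → Pt (G ⊕ ω-power) → Set g where
    first : ∀ {x} → Unfold (0 , x) (inj₁ x)
    later : ∀ {n x} → Unfold (suc n , x) (inj₂ (n , x))

  unfold-≅ : ω-power ≅ G ⊕ ω-power
  unfold-≅ = record
    { _~_     = Unfold
    ; to      = λ { (zero , x) → _ , first ; (suc n , x) → _ , later }
    ; from    = λ { (inj₁ x) → _ , first ; (inj₂ (n , x)) → _ , later }
    ; color-≡ = λ { first → refl ; later → refl }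
    ; to-<    = λ { first first (inj₂ (_ , p)) → Level.lift p ; first later _ → tt
                  ; later later (inj₁ (s≤s p)) → Level.lift (inj₁ p)
                  ; later later (inj₂ (refl , p)) → Level.lift (inj₂ (refl , p)) }
    ; from-<  = λ { first first (Level.lift p) → inj₂ (refl , p)
                  ; first later _ → inj₁ (s≤s z≤n)
                  ; later first (Level.lift ())
                  ; later later (Level.lift (inj₁ p)) → inj₁ (s≤s p)
                  ; later later (Level.lift (inj₂ (refl , p))) → inj₂ (refl , p) }
    }

  repeat : ℕ → Lin d g
  repeat zero    = ∅
  repeat (suc n) = G ⊕ repeat n

-- Characters of the points of an interval between two fixed orders.

module Contexts (em : ∀ {ℓ : Level} → ExcludedMiddle ℓ) (d : ℕ) where

  open Types em d
  open Intervals em d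

  -- Compares the characters of x in H ⊕ A ⊕ R and of x′ in H′ ⊕ A′ ⊕ R′.

  record SimilarIn (h t : ℕ) {a b c a′ b′ c′}
                   (H : Lin d a) (A : Lin d b) (R : Lin d c)
                   (H′ : Lin d a′) (A′ : Lin d b′) (R′ : Lin d c′)
                   (x : Pt A) (x′ : Pt A′) : Set where
    constructor similarIn
    field
      color-≡ᶜ : color A x ≡ color A′ x′
      head     : H ⊕ A ↓ x ≈[ h ] H′ ⊕ A′ ↓ x′
      tail     : A ↑ x ⊕ R ≈[ t ] A′ ↑ x′ ⊕ R′
  open SimilarIn public

  module _ {a b c a′ b′ c′ : Level} {H : Lin d a} {A : Lin d b} {R : Lin d c}
           {H′ : Lin d a′} {A′ : Lin d b′} {R′ : Lin d c′} where

    SimilarIn-sym : ∀ {h t x x′} → SimilarIn h t H A R H′ A′ R′ x x′ →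
                    SimilarIn h t H′ A′ R′ H A R x′ x
    SimilarIn-sym (similarIn p q r) = similarIn (sym p) (≈-sym q) (≈-sym r)

    SimilarIn-trans : ∀ {a″ b″ c″} {H″ : Lin d a″} {A″ : Lin d b″} {R″ : Lin d c″}
      {h t x x′ x″} → SimilarIn h t H A R H′ A′ R′ x x′ →
      SimilarIn h t H′ A′ R′ H″ A″ R″ x′ x″ → SimilarIn h t H A R H″ A″ R″ x x″
    SimilarIn-trans (similarIn p q r) (similarIn p′ q′ r′) =
      similarIn (trans p p′) (q ⨾ q′) (r ⨾ r′)

    SimilarIn-≤ : ∀ {h t h′ t′ x x′} → h′ ≤ h → t′ ≤ t → SimilarIn h t H A R H′ A′ R′ x x′ →
                  SimilarIn h′ t′ H A R H′ A′ R′ x x′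
    SimilarIn-≤ l m (similarIn p q r) = similarIn p (≈-≤ l q) (≈-≤ m r)

  module _ {a b c : Level} (H : Lin d a) (A : Lin d b) (R : Lin d c) where

    ↓-in : ∀ {j} x → (H ⊕ A ⊕ R) ↓ inj₂ (inj₁ x) ≈[ j ] H ⊕ A ↓ x
    ↓-in x = ≅⇒≈ ⊕-↓ʳ ⨾ ⊕-cong ≈-refl (≅⇒≈ ⊕-↓ˡ)

    ↑-in : ∀ {j} x → (H ⊕ A ⊕ R) ↑ inj₂ (inj₁ x) ≈[ j ] A ↑ x ⊕ R
    ↑-in x = ≅⇒≈ ⊕-↑ʳ ⨾ ≅⇒≈ ⊕-↑ˡ

    middle : Part d (a ⊔ b ⊔ c)
    middle = record
      { whole   = H ⊕ A ⊕ R
      ; Lo      = Lo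
      ; Hi      = Hi
      ; Lo-up   = λ {x} {y} → up x y
      ; Hi-down = λ {x} {y} → down x y
      }
      where
      Lo Hi : Pred (Pt (H ⊕ A ⊕ R)) (a ⊔ b ⊔ c)
      Lo (inj₁ _) = Level.Lift _ ⊥
      Lo (inj₂ _) = ⊤
      Hi (inj₁ _)        = ⊤
      Hi (inj₂ (inj₁ _)) = ⊤
      Hi (inj₂ (inj₂ _)) = Level.Lift _ ⊥
      up : ∀ x y → Lo x → ¬ (H ⊕ A ⊕ R) ∋ y < x → Lo y
      up (inj₂ _) (inj₁ _) _ p = contradiction tt p
      up (inj₂ _) (inj₂ _) _ p = tt
      up (inj₁ _) _ (Level.lift ())
      down : ∀ x y → Hi x → ¬ (H ⊕ A ⊕ R) ∋ x < y → Hi y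
      down _ (inj₁ _) _ _ = tt
      down _ (inj₂ (inj₁ _)) _ _ = tt
      down (inj₁ _) (inj₂ (inj₂ _)) _ p = contradiction tt p
      down (inj₂ (inj₁ _)) (inj₂ (inj₂ _)) _ p = contradiction (Level.lift tt) p
      down (inj₂ (inj₂ _)) (inj₂ (inj₂ _)) (Level.lift ())

    open Part middle

    inside : Pt A → Pt (H ⊕ A ⊕ R)
    inside x = inj₂ (inj₁ x)

    In-elim : ∀ {ℓ} {P : Pred (Pt (H ⊕ A ⊕ R)) ℓ} → (∀ x → P (inside x)) → ∀ {x} → In x → P x
    In-elim f {inj₂ (inj₁ x)} _ = f x
    In-elim f {inj₁ _} (Level.lift () , _)
    In-elim f {inj₂ (inj₂ _)} (_ , Level.lift ())

    data Inside : Pt (segment nothing nothing) → Pt A → Set (a ⊔ b ⊔ c) where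
      same : ∀ {x p} → Inside (inj₂ (inj₁ x) , p) x

    inside-≅ : segment nothing nothing ≅ A
    inside-≅ = record
      { _~_     = Inside
      ; to      = λ { (inj₁ _ , (Level.lift () , _)) ; (inj₂ (inj₁ x) , _) → x , same
                    ; (inj₂ (inj₂ _) , (_ , Level.lift ())) }
      ; from    = λ x → (inside x , (tt , tt)) , same
      ; color-≡ = λ { same → refl }
      ; to-<    = λ { same same (Level.lift (Level.lift p)) → p }
      ; from-<  = λ { same same p → Level.lift (Level.lift p) }
      }

    initial-≈ : ∀ {j} x → segment nothing (just (inside x)) ≈[ j ] A ↓ x
    initial-≈ x = ≈-sym (≅⇒≈ (PartProperties.segment-↓ middle nothing nothing (tt , tt)))
                  ⨾ ≅⇒≈ (↓-≅ inside-≅ same)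

    before-middle : ∀ {j} → before nothing ≈[ j ] H
    before-middle = ≅⇒≈ record
      { _~_     = _~_
      ; to      = λ { (inj₁ x , _) → x , same ; (inj₂ _ , p) → contradiction tt p }
      ; from    = λ x → (inj₁ x , Level.lower) , same
      ; color-≡ = λ { same → refl }
      ; to-<    = λ { same same (Level.lift p) → p }
      ; from-<  = λ { same same p → Level.lift p }
      }
      where
      data _~_ : Pt (before nothing) → Pt H → Set (a ⊔ b ⊔ c) where
        same : ∀ {x p} → (inj₁ x , p) ~ x

    after-middle : ∀ {j} → after nothing ≈[ j ] R
    after-middle = ≅⇒≈ record
      { _~_     = _~_
      ; to      = λ { (inj₂ (inj₂ x) , _) → x , same ; (inj₁ _ , p) → contradiction tt p
                    ; (inj₂ (inj₁ _) , p) → contradiction tt p }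
      ; from    = λ x → (inj₂ (inj₂ x) , Level.lower) , same
      ; color-≡ = λ { same → refl }
      ; to-<    = λ { same same (Level.lift (Level.lift p)) → p }
      ; from-<  = λ { same same p → Level.lift (Level.lift p) }
      }
      where
      data _~_ : Pt (after nothing) → Pt R → Set (a ⊔ b ⊔ c) where
        same : ∀ {x p} → (inj₂ (inj₂ x) , p) ~ x

  module _ {a b c a′ b′ c′ : Level} {H : Lin d a} {A : Lin d b} {R : Lin d c}
           {H′ : Lin d a′} {A′ : Lin d b′} {R′ : Lin d c′} where

    SimilarIn⇒Similar : ∀ {j x x′} → SimilarIn j j H A R H′ A′ R′ x x′ →
      Similar j (H ⊕ A ⊕ R) (H′ ⊕ A′ ⊕ R′) (inside H A R x) (inside H′ A′ R′ x′)
    SimilarIn⇒Similar {x = x} {x′} s = similar (color-≡ᶜ s)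
      (↓-in H A R x ⨾ head s ⨾ ≈-sym (↓-in H′ A′ R′ x′))
      (↑-in H A R x ⨾ tail s ⨾ ≈-sym (↑-in H′ A′ R′ x′))

-- Replacing a recurrent interval by G^ω.

module Powers (em : ∀ {ℓ : Level} → ExcludedMiddle ℓ) (d : ℕ) where

  open Types em d
  open Intervals em d
  open Contexts em d

  module _ (G : Lin d g) where
    private
      K : Lin d g
      K = ω-power G

    repeat-⊕-ω-power : ∀ {j} n → repeat G n ⊕ K ≈[ j ] K
    repeat-⊕-ω-power zero    = ≅⇒≈ ⊕-identityˡ
    repeat-⊕-ω-power (suc n) = ≅⇒≈ ⊕-assoc ⨾ ⊕-cong ≈-refl (repeat-⊕-ω-power n)
                               ⨾ ≈-sym (≅⇒≈ (unfold-≅ G))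

    ω-power-↓-zero : ∀ {j x} → K ↓ (0 , x) ≈[ j ] G ↓ x
    ω-power-↓-zero = ≅⇒≈ (↓-≅ (unfold-≅ G) first) ⨾ ≅⇒≈ ⊕-↓ˡ

    ω-power-↓-suc : ∀ {j n x} → K ↓ (suc n , x) ≈[ j ] G ⊕ K ↓ (n , x)
    ω-power-↓-suc = ≅⇒≈ (↓-≅ (unfold-≅ G) later) ⨾ ≅⇒≈ ⊕-↓ʳ

    ω-power-↑-suc : ∀ {j n x} → K ↑ (suc n , x) ≈[ j ] K ↑ (n , x)
    ω-power-↑-suc = ≅⇒≈ (↑-≅ (unfold-≅ G) later) ⨾ ≅⇒≈ ⊕-↑ʳ

    ω-power-↑ : ∀ {j} n {x} → K ↑ (n , x) ≈[ j ] G ↑ x ⊕ K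
    ω-power-↑ zero    = ≅⇒≈ (↑-≅ (unfold-≅ G) first) ⨾ ≅⇒≈ ⊕-↑ˡ
    ω-power-↑ (suc n) = ω-power-↑-suc ⨾ ω-power-↑ n

    -- Used to carry a deep initial segment found in G^ω over to a finite prefix; `above≈` puts G^ω
    -- back behind the prefix.
    record InRepeat (n m : ℕ) (x : Pt G) : Set g where
      field
        place   : Pt (repeat G n)
        color≡  : color (repeat G n) place ≡ color G x
        below≈  : ∀ {j} → repeat G n ↓ place ≈[ j ] K ↓ (m , x)
        above≈  : ∀ {j} → repeat G n ↑ place ⊕ K ≈[ j ] K ↑ (m , x)

    inRepeat : ∀ {n m} → m ℕ.< n → ∀ x → InRepeat n m x
    inRepeat {suc n} {zero} p x = record
      { place  = inj₁ x
      ; color≡ = refl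
      ; below≈ = ≅⇒≈ ⊕-↓ˡ ⨾ ≈-sym ω-power-↓-zero
      ; above≈ = ⊕-cong (≅⇒≈ ⊕-↑ˡ) ≈-refl ⨾ ≅⇒≈ ⊕-assoc
                 ⨾ ⊕-cong ≈-refl (repeat-⊕-ω-power n) ⨾ ≈-sym (ω-power-↑ 0)
      }
    inRepeat {suc n} {suc m} (s≤s p) x = record
      { place  = inj₂ place
      ; color≡ = color≡
      ; below≈ = ≅⇒≈ ⊕-↓ʳ ⨾ ⊕-cong ≈-refl below≈ ⨾ ≈-sym ω-power-↓-suc
      ; above≈ = ⊕-cong (≅⇒≈ ⊕-↑ʳ) ≈-refl ⨾ above≈ ⨾ ≈-sym ω-power-↑-suc
      }
      where open InRepeat (inRepeat p x)

    module _ {H : Lin d a} {p : ℕ} (absorb : H ⊕ G ≈[ p ] H) where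

      repeat-absorb : ∀ n → H ⊕ repeat G n ≈[ p ] H
      repeat-absorb zero    = ≅⇒≈ (⊕-identityʳ {b = g})
      repeat-absorb (suc n) = ≈-sym (≅⇒≈ ⊕-assoc) ⨾ ⊕-cong absorb ≈-refl ⨾ repeat-absorb n

      -- The complete copies of `G` below the point vanish into `H`, so its left context does not
      -- depend on `n`.
      ω-power-head : ∀ n {x} → H ⊕ K ↓ (n , x) ≈[ p ] H ⊕ G ↓ x
      ω-power-head zero    = ⊕-cong ≈-refl ω-power-↓-zero
      ω-power-head (suc n) = ⊕-cong ≈-refl ω-power-↓-suc ⨾ ≈-sym (≅⇒≈ ⊕-assoc)
                             ⨾ ⊕-cong absorb ≈-refl ⨾ ω-power-head n

    module _ {H : Lin d a} {Y : Lin d b} {p : ℕ}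
             (absorbˡ : H ⊕ G ≈[ p ] H) (absorbʳ : G ⊕ Y ≈[ p ] Y) where

      repeat-absorbʳ : ∀ n → repeat G n ⊕ Y ≈[ p ] Y
      repeat-absorbʳ zero    = ≅⇒≈ ⊕-identityˡ
      repeat-absorbʳ (suc n) = ≅⇒≈ ⊕-assoc ⨾ ⊕-cong ≈-refl (repeat-absorbʳ n) ⨾ absorbʳ

      repeat-character : ∀ n w → ∃[ x ] SimilarIn p p H (repeat G n) Y H G Y w x
      repeat-character (suc n) (inj₁ x) = x , similarIn refl
        (⊕-cong ≈-refl (≅⇒≈ ⊕-↓ˡ))
        (⊕-cong (≅⇒≈ ⊕-↑ˡ) ≈-refl ⨾ ≅⇒≈ ⊕-assoc ⨾ ⊕-cong ≈-refl (repeat-absorbʳ n))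
      repeat-character (suc n) (inj₂ w) =
        let x , s = repeat-character n w
        in x , similarIn (color-≡ᶜ s)
             (⊕-cong ≈-refl (≅⇒≈ ⊕-↓ʳ) ⨾ ≈-sym (≅⇒≈ ⊕-assoc)
              ⨾ ⊕-cong absorbˡ ≈-refl ⨾ head s)
             (⊕-cong (≅⇒≈ ⊕-↑ʳ) ≈-refl ⨾ tail s)
      repeat-character zero (Level.lift ())

  -- `G` will replace the stretch of `I` from its least point up to a later point of the same
  -- character. Equality of these characters is the source of both absorption laws; `refersᴳ` and
  -- `hits` say that `G`, placed before `I ⊕ R`, shows exactly the characters of `I`.
  module Power {a g} {p : ℕ} (H I R : Lin d a) (G : Lin d g)
    (absorbˡ : H ⊕ G ≈[ p ] H)
    (absorbʳ : G ⊕ I ⊕ R ≈[ p ] I ⊕ R)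
    (refersᴳ : ∀ x → ∃[ k ] SimilarIn p p H G (I ⊕ R) H I R x k)
    (hits    : ∀ k → ∃[ x ] SimilarIn p p H G (I ⊕ R) H I R x k)
    (recurs  : ∀ k c → ∃[ x ] I ∋ c < x × SimilarIn p p H I R H I R x k)
    (point₀  : Pt I)
    where

    private
      K : Lin d g
      K = ω-power G
      D : ℕ → Lin d g
      D = repeat G

    open Reference (H ⊕ I ⊕ R) (inside H I R)

    -- What the comparison uses of `I` and of G^ω alike. Left contexts are compared at full rank
    -- `p`, right contexts only at the rank `j` that the induction on tails has reached.
    record Good (j : ℕ) (X : Lin d ℓ) : Set (a ⊔ ℓ) where
      field
        tails   : X ⊕ R ≈[ j ] I ⊕ R
        refers  : ∀ x → ∃[ k ] SimilarIn p j H X R H I R x k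
        cofinal : ∀ k c → ∃[ x ] X ∋ c < x × SimilarIn p j H X R H I R x k
        pt      : Pt X

    module _ {j : ℕ} (j≤p : j ≤ p) where

      Good-I : Good j I
      Good-I = record
        { tails   = ≈-refl
        ; refers  = λ k → k , similarIn refl ≈-refl ≈-refl
        ; cofinal = λ k c → let x , q , s = recurs k c in x , q , SimilarIn-≤ ℕ.≤-refl j≤p s
        ; pt      = point₀
        }

      -- A point of any copy sees the rest of its copy followed by `K ⊕ R`. Knowing this tail at
      -- rank `j` turns right contexts into those of `G` before `I ⊕ R`, to which `refersᴳ` and
      -- `hits` apply.
      Good-K : K ⊕ R ≈[ j ] I ⊕ R → Good j K
      Good-K eq = record
        { tails   = eq
        ; refers  = λ { (n , x) → let k , s = refersᴳ x in
                        k , SimilarIn-trans (char n) (SimilarIn-≤ ℕ.≤-refl j≤p s) }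
        ; cofinal = λ { k (n , c) → let x , s = hits k in
                        (suc n , x) , inj₁ ℕ.≤-refl ,
                        SimilarIn-trans (char (suc n)) (SimilarIn-≤ ℕ.≤-refl j≤p s) }
        ; pt      = 0 , proj₁ (hits point₀)
        }
        where
        char : ∀ n {x} → SimilarIn p j H K R H G (I ⊕ R) (n , x) x
        char n = similarIn refl (ω-power-head G absorbˡ n)
          (⊕-cong (ω-power-↑ G n) ≈-refl ⨾ ≅⇒≈ ⊕-assoc ⨾ ⊕-cong ≈-refl eq)

      Good-repeat : ∀ n {X : Lin d ℓ} → Good j X → Good j (D n ⊕ X)
      Good-repeat n {X} good = record
        { tails   = ≅⇒≈ ⊕-assoc ⨾ ⊕-cong ≈-refl tails
                    ⨾ ≈-≤ j≤p (repeat-absorbʳ G {H = H} absorbˡ absorbʳ n)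
        ; refers  = λ
            { (inj₁ w) → let x , s = repeat-character G absorbˡ absorbʳ n w
                             k , t = refersᴳ x
                         in k , SimilarIn-trans (left w)
                                  (SimilarIn-≤ ℕ.≤-refl j≤p (SimilarIn-trans s t))
            ; (inj₂ x) → let k , s = refers x in k , SimilarIn-trans (right x) s }
        ; cofinal = λ
            { k (inj₁ w) → let x , _ , s = cofinal k pt in inj₂ x , tt , SimilarIn-trans (right x) s
            ; k (inj₂ c) → let x , q , s = cofinal k c in
                           inj₂ x , Level.lift q , SimilarIn-trans (right x) s }
        ; pt      = inj₂ pt
        }
        where
        open Good good
        left : ∀ w → SimilarIn p j H (D n ⊕ X) R H (D n) (I ⊕ R) (inj₁ w) w
        left w = similarIn refl (⊕-cong ≈-refl (≅⇒≈ ⊕-↓ˡ))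
          (⊕-cong (≅⇒≈ ⊕-↑ˡ) ≈-refl ⨾ ≅⇒≈ ⊕-assoc ⨾ ⊕-cong ≈-refl tails)
        right : ∀ x → SimilarIn p j H (D n ⊕ X) R H X R (inj₂ x) x
        right x = similarIn refl
          (⊕-cong ≈-refl (≅⇒≈ ⊕-↓ʳ) ⨾ ≈-sym (≅⇒≈ ⊕-assoc)
           ⨾ ⊕-cong (repeat-absorb G absorbˡ n) ≈-refl)
          (⊕-cong (≅⇒≈ ⊕-↑ʳ) ≈-refl)

      Good⇒Recurrent : {X : Lin d ℓ} → Good j X → Recurrent (middle H X R) j
      Good⇒Recurrent {X = X} good = record
        { refers    = In-elim H X R {P = λ x → ∃[ k ] Similar j _ _ x _}
            (λ x → let k , s = refers x in
                   k , SimilarIn⇒Similar (SimilarIn-≤ j≤p ℕ.≤-refl s))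
        ; cofinal   = λ k → In-elim H X R
            {P = λ c → ∃[ x ] ((H ⊕ X ⊕ R) ∋ c < x × Part.In (middle H X R) x) × Similar j _ _ x _}
            (λ c → let x , q , s = cofinal k c in
                   inside H X R x , (Level.lift (Level.lift q) , (tt , tt)) ,
                   SimilarIn⇒Similar (SimilarIn-≤ j≤p ℕ.≤-refl s))
        ; inhabited = inside H X R pt , (tt , tt)
        }
        where open Good good

    module _ {j : ℕ} (j≤p : j ≤ p) (K≈I : K ⊕ R ≈[ j ] I ⊕ R) where

      -- Some number of initial copies of G in G^ω is deep; these copies serve as a
      -- common prefix when I is compared with G^ω.

      deep-start : ∃[ m ] ∃[ x ] Deep (middle H K R) (suc j) nothing (just (inside H K R (m , x)))
      deep-start = go (R.reach (suc j) ℕ.≤-refl {inside H K R pt} (tt , tt))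
        where
        open Good (Good-K j≤p K≈I)
        module R = RecurrentProperties (middle H K R) (Good⇒Recurrent j≤p (Good-K j≤p K≈I))
        go : ∃[ e ] (_ × Part.In (middle H K R) e) × Deep (middle H K R) (suc j) _ (just e) →
             ∃[ m ] ∃[ x ] Deep (middle H K R) (suc j) nothing (just (inside H K R (m , x)))
        go (inj₂ (inj₁ (m , x)) , _ , D′) = m , x , Deep-mono (middle H K R) (suc j)
          (λ {y} → PartProperties.low-up (middle H K R) nothing {inside H K R pt} {y} tt) id D′
        go (inj₁ _ , (_ , Level.lift () , _) , _)
        go (inj₂ (inj₂ _) , (_ , _ , Level.lift ()) , _)

    module _ {j : ℕ} (j≤p : j ≤ p) (K≈I : K ⊕ R ≈[ j ] I ⊕ R) {m : ℕ} {x₀ : Pt G}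
      (deep₀ : Deep (middle H K R) (suc j) nothing (just (inside H K R (m , x₀))))
      (place₀ : InRepeat G (suc m) m x₀) where

      private
        N : ℕ
        N = suc m

        open InRepeat place₀

        P : Lin d ℓ → Part d (a ⊔ g ⊔ ℓ)
        P X = middle H (D N ⊕ X) R

        -- Up to the chosen place the prefix looks like G^ω, and what follows has the same `j`-type
        -- whichever `X` comes after the prefix; so depth carries over by `Deep-transfer`.
        deep-place : {X : Lin d ℓ} → X ⊕ R ≈[ j ] I ⊕ R →
                     Deep (P X) (suc j) nothing (just (inside H (D N ⊕ X) R (inj₁ place)))
        deep-place {X = X} eq = Transfer.Deep-transfer (middle H K R) (P X) (suc j)
          {nothing} {just _} {nothing} {just _}
          (before-middle H K R ⨾ ≈-sym (before-middle H (D N ⊕ X) R))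
          (Transfer.after-cong (middle H K R) (P X) (sym color≡)
            (↑-in H K R _ ⨾ ⊕-cong (≈-sym above≈) ≈-refl ⨾ ≅⇒≈ ⊕-assoc
             ⨾ ⊕-cong ≈-refl (K≈I ⨾ ≈-sym eq)
             ⨾ ≈-sym (≅⇒≈ ⊕-assoc) ⨾ ⊕-cong (≈-sym (≅⇒≈ ⊕-↑ˡ)) ≈-refl
             ⨾ ≈-sym (↑-in H (D N ⊕ X) R (inj₁ place))))
          (initial-≈ H K R _ ⨾ ≈-sym below≈ ⨾ ≈-sym (≅⇒≈ ⊕-↓ˡ)
           ⨾ ≈-sym (initial-≈ H (D N ⊕ X) R (inj₁ place)))
          deep₀

        deep-beyond : {X : Lin d ℓ} → X ⊕ R ≈[ j ] I ⊕ R → ∀ x →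
                      Deep (P X) (suc j) nothing (just (inside H (D N ⊕ X) R (inj₂ x)))
        deep-beyond {X = X} eq x = Deep-mono (P X) (suc j) {nothing} {nothing} {just _} {just _} id
          (λ {y} q → Lin.<-trans (H ⊕ (D N ⊕ X) ⊕ R) {y} {inside H (D N ⊕ X) R (inj₁ place)}
                       q (Level.lift (Level.lift tt)))
          (deep-place eq)

        deep-all : {X : Lin d ℓ} → X ⊕ R ≈[ j ] I ⊕ R → Deep (P X) (suc j) nothing nothing
        deep-all {X = X} eq = Deep-mono (P X) (suc j) {nothing} {nothing} {just place′} {nothing} id
          (λ {y} → PartProperties.high-down (P X) nothing {y} {place′} tt) (deep-place eq)
          where place′ = inside H (D N ⊕ X) R (inj₁ place)

      module _ {ℓ ℓ′} {X : Lin d ℓ} {Y : Lin d ℓ′} (gX : Good j X) (gY : Good j Y) where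
        private
          module X = Good gX
          module Y = Good gY
          Y≈X : Y ⊕ R ≈[ j ] X ⊕ R
          Y≈X = Y.tails ⨾ ≈-sym X.tails

        prefix-similar : ∀ w → SimilarIn j j H (D N ⊕ X) R H (D N ⊕ Y) R (inj₁ w) (inj₁ w)
        prefix-similar w = similarIn refl
          (⊕-cong ≈-refl (≅⇒≈ ⊕-↓ˡ ⨾ ≈-sym (≅⇒≈ ⊕-↓ˡ)))
          (⊕-cong (≅⇒≈ ⊕-↑ˡ) ≈-refl ⨾ ≅⇒≈ ⊕-assoc ⨾ ⊕-cong ≈-refl (≈-sym Y≈X)
           ⨾ ≈-sym (≅⇒≈ ⊕-assoc) ⨾ ⊕-cong (≈-sym (≅⇒≈ ⊕-↑ˡ)) ≈-refl)

        compatible : Transfer.Compatible (P X) (P Y) j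
        compatible = record
          { before≈ = before-middle H (D N ⊕ X) R ⨾ ≈-sym (before-middle H (D N ⊕ Y) R)
          ; after≈  = after-middle H (D N ⊕ X) R ⨾ ≈-sym (after-middle H (D N ⊕ Y) R)
          ; prefix  = In-elim H (D N ⊕ X) R {P = λ x → Deep (P X) (suc j) nothing (just x) ⊎
              ∃[ x′ ] Part.In (P Y) x′ × Similar j (Part.whole (P X)) (Part.whole (P Y)) x x′ ×
              Part.segment (P X) nothing (just x) ≈[ j ] Part.segment (P Y) nothing (just x′)} λ
              { (inj₁ w) → inj₂ (_ , (tt , tt) , SimilarIn⇒Similar (prefix-similar w) ,
                  (initial-≈ H (D N ⊕ X) R (inj₁ w) ⨾ ≅⇒≈ ⊕-↓ˡ
                   ⨾ ≈-sym (≅⇒≈ ⊕-↓ˡ) ⨾ ≈-sym (initial-≈ H (D N ⊕ Y) R (inj₁ w))))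
              ; (inj₂ x) → inj₁ (deep-beyond X.tails x) }
          }

      module _ {ℓ ℓ′} {X : Lin d ℓ} {Y : Lin d ℓ′} (gX : Good j X) (gY : Good j Y) where
        private
          module X = Good gX
          module Y = Good gY

          alikeXY : Transfer.Alike (P X) (P Y) j
          alikeXY = alike (P X) (P Y) (compatible gX gY) (compatible gY gX)
            (Good⇒Recurrent j≤p (Good-repeat j≤p N gX))
            (Good⇒Recurrent j≤p (Good-repeat j≤p N gY)) ℕ.≤-refl

        prefixed-≈ : D N ⊕ X ≈[ j ] D N ⊕ Y
        prefixed-≈ = ≈-sym (≅⇒≈ (inside-≅ H (D N ⊕ X) R))
          ⨾ alikeXY Transfer.start Transfer.end (deep-all X.tails) (deep-all Y.tails) _,_ _,_
          ⨾ ≅⇒≈ (inside-≅ H (D N ⊕ Y) R)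

        -- Here the rank of the tails grows by one. A move in `X` is answered by a point of `Y` with
        -- the same reference character: right contexts agree at rank `j`, as the remaining rounds
        -- require, while left contexts agree at rank `p`, which covers the extra rank that
        -- `HighMatch` wants below the point.
        prefixed-forth : suc j ≤ p → ∀ u →
          ∃[ v ] Similar j ((D N ⊕ X) ⊕ R) ((D N ⊕ Y) ⊕ R) u v
        prefixed-forth j<p (inj₂ r) = inj₂ r , similar refl
          (≅⇒≈ ⊕-↓ʳ ⨾ ⊕-cong prefixed-≈ ≈-refl ⨾ ≈-sym (≅⇒≈ ⊕-↓ʳ))
          (≅⇒≈ ⊕-↑ʳ ⨾ ≈-sym (≅⇒≈ ⊕-↑ʳ))
        prefixed-forth j<p (inj₁ (inj₁ w)) = inj₁ (inj₁ w) , similar refl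
          (≅⇒≈ ⊕-↓ˡ ⨾ ≅⇒≈ ⊕-↓ˡ ⨾ ≈-sym (≅⇒≈ ⊕-↓ˡ) ⨾ ≈-sym (≅⇒≈ ⊕-↓ˡ))
          (≅⇒≈ ⊕-↑ˡ ⨾ tail (prefix-similar gX gY w) ⨾ ≈-sym (≅⇒≈ ⊕-↑ˡ))
        prefixed-forth j<p (inj₁ (inj₂ x)) =
          let k , s     = Good.refers (Good-repeat j≤p N gX) (inj₂ x)
              y , _ , t = Y.cofinal k Y.pt
              x′ = inj₂ x
              y′ = inj₂ y
              s′ = SimilarIn-trans s (SimilarIn-sym (SimilarIn-trans (beyond y) t))
              i₀ = Transfer.at {P = P X} {P′ = P Y} (color-≡ᶜ s′)
                     (↓-in H (D N ⊕ X) R x′ ⨾ ≈-≤ j<p (head s′) ⨾ ≈-sym (↓-in H (D N ⊕ Y) R y′))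
                     (↑-in H (D N ⊕ X) R x′ ⨾ tail s′ ⨾ ≈-sym (↑-in H (D N ⊕ Y) R y′))
              eq = ≈-sym (initial-≈ H (D N ⊕ X) R x′)
                   ⨾ alikeXY Transfer.start i₀ (deep-beyond X.tails x) (deep-beyond Y.tails y)
                       (λ {z} p q → p , PartProperties.high-down (P X) nothing {z} {inside H (D N ⊕ X) R x′} tt q)
                       (λ {z} p q → p , PartProperties.high-down (P Y) nothing {z} {inside H (D N ⊕ Y) R y′} tt q)
                   ⨾ initial-≈ H (D N ⊕ Y) R y′
          in inj₁ y′ , similar (color-≡ᶜ s′)
               (≅⇒≈ ⊕-↓ˡ ⨾ eq ⨾ ≈-sym (≅⇒≈ ⊕-↓ˡ))
               (≅⇒≈ ⊕-↑ˡ ⨾ tail s′ ⨾ ≈-sym (≅⇒≈ ⊕-↑ˡ))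
          where
          beyond : ∀ y → SimilarIn p j H (D N ⊕ Y) R H Y R (inj₂ y) y
          beyond y = similarIn refl
            (⊕-cong ≈-refl (≅⇒≈ ⊕-↓ʳ) ⨾ ≈-sym (≅⇒≈ ⊕-assoc)
             ⨾ ⊕-cong (repeat-absorb G absorbˡ N) ≈-refl)
            (⊕-cong (≅⇒≈ ⊕-↑ʳ) ≈-refl)

      tail-suc : suc j ≤ p → K ⊕ R ≈[ suc j ] I ⊕ R
      tail-suc j<p =
        ⊕-cong (≈-sym (repeat-⊕-ω-power G N)) ≈-refl
        ⨾ back-and-forth (prefixed-forth gK gI j<p) (prefixed-forth gI gK j<p)
        ⨾ ≅⇒≈ ⊕-assoc ⨾ ≈-≤ j<p (repeat-absorbʳ G {H = H} absorbˡ absorbʳ N)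
        where
        gK = Good-K j≤p K≈I
        gI = Good-I j≤p

      head-≈ : j ≡ p → H ⊕ K ≈[ p ] H ⊕ I
      head-≈ refl =
        ⊕-cong ≈-refl (≈-sym (repeat-⊕-ω-power G N)
                       ⨾ prefixed-≈ (Good-K j≤p K≈I) (Good-I j≤p))
        ⨾ ≈-sym (≅⇒≈ ⊕-assoc) ⨾ ⊕-cong (repeat-absorb G absorbˡ N) ≈-refl

    ω-power-tail : ∀ j → j ≤ p → K ⊕ R ≈[ j ] I ⊕ R
    ω-power-tail zero    _   = ≈-zero
    ω-power-tail (suc j) j<p =
      let j≤p       = ℕ.≤-trans (ℕ.n≤1+n j) j<p
          ih        = ω-power-tail j j≤p
          m , x , D = deep-start j≤p ih
      in tail-suc j≤p ih D (inRepeat G ℕ.≤-refl x) j<p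

    ω-power-heads : H ⊕ K ≈[ p ] H ⊕ I
    ω-power-heads =
      let K≈I       = ω-power-tail p ℕ.≤-refl
          m , x , D = deep-start ℕ.≤-refl K≈I
      in head-≈ ℕ.≤-refl K≈I D (inRepeat G ℕ.≤-refl x) refl

    ω-power-characters : ∀ u → ∃[ k ] SimilarIn p p H K R H I R u k
    ω-power-characters = Good.refers (Good-K ℕ.≤-refl (ω-power-tail p ℕ.≤-refl))

-- Order types measured by embeddings into powers of ω.

record Embeds (i : ℕ) (W : Lin d 0ℓ) : Set where
  field
    map  : Pt W → Ordinal.Carrier (ω ^ᴼ i)
    mono : ∀ {x y} → W ∋ x < y → Ordinal._<_ (ω ^ᴼ i) (map x) (map y)

-- Type at most ω^i times a finite number: the leading coordinate of ω^(i+1) counts copies of ω^i.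
-- Only increasing maps are tracked; `monotone⇒≼` recovers initial segments at the end.
record Bounded (i : ℕ) (W : Lin d 0ℓ) : Set where
  field
    embeds : Embeds (suc i) W
    bound  : ℕ
  open Embeds embeds public
  field
    bounded : ∀ x → proj₁ (map x) ℕ.< bound

Embeds⇒Bounded : {W : Lin d 0ℓ} → Embeds i W → Bounded i W
Embeds⇒Bounded E = record
  { embeds  = record { map = λ x → 0 , map x ; mono = λ p → inj₂ (refl , mono p) }
  ; bound   = 1
  ; bounded = λ _ → s≤s z≤n
  }
  where open Embeds E

Embeds-∅ : Embeds {d} i ∅
Embeds-∅ = record { map = λ () ; mono = λ {x} → ⊥-elim (Level.lower x) }

-- A bounded summand in front is absorbed: shifting the leading coordinate of the second summand
-- makes room without raising the exponent.
Embeds-⊕ : {V W : Lin d 0ℓ} → Bounded i V → Embeds (suc i) W → Embeds (suc i) (V ⊕ W)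
Embeds-⊕ {i = i} {V} {W} B E = record { map = map ; mono = λ {x} {y} → mono x y }
  where
  module B = Bounded B
  module E = Embeds E
  map : Pt (V ⊕ W) → Ordinal.Carrier (ω ^ᴼ suc i)
  map (inj₁ x) = B.map x
  map (inj₂ x) = B.bound + proj₁ (E.map x) , proj₂ (E.map x)
  mono : ∀ x y → (V ⊕ W) ∋ x < y → Ordinal._<_ (ω ^ᴼ suc i) (map x) (map y)
  mono (inj₁ x) (inj₁ y) (Level.lift p) = B.mono p
  mono (inj₁ x) (inj₂ y) _ = inj₁ (ℕ.<-≤-trans (B.bounded x) (ℕ.m≤m+n _ _))
  mono (inj₂ x) (inj₁ y) (Level.lift ())
  mono (inj₂ x) (inj₂ y) (Level.lift p) with E.mono p
  ... | inj₁ q       = inj₁ (ℕ.+-monoʳ-< B.bound q)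
  ... | inj₂ (q , r) = inj₂ (cong (B.bound +_) q , r)

Bounded-⊕ : {V W : Lin d 0ℓ} → Bounded i V → Bounded i W → Bounded i (V ⊕ W)
Bounded-⊕ B C = record
  { embeds  = Embeds-⊕ B C.embeds
  ; bound   = B.bound + C.bound
  ; bounded = λ { (inj₁ x) → ℕ.<-≤-trans (B.bounded x) (ℕ.m≤m+n _ _)
                ; (inj₂ x) → ℕ.+-monoʳ-< B.bound (C.bounded x) }
  }
  where
  module B = Bounded B
  module C = Bounded C

bottom : ∀ i → Ordinal.Carrier (ω ^ᴼ i)
bottom zero    = zero
bottom (suc i) = 0 , bottom i

Bounded-point : ∀ {k} → Bounded {d} i (point k)
Bounded-point {i = i} = record
  { embeds  = record { map = λ _ → 0 , bottom i ; mono = λ () }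
  ; bound   = 1
  ; bounded = λ _ → s≤s z≤n
  }

Embeds-ω-power : {W : Lin d 0ℓ} → Bounded i W → Embeds (suc i) (ω-power W)
Embeds-ω-power {i = i} {W} B = record
  { map  = λ { (n , x) → n *ℕ bound + proj₁ (map x) , proj₂ (map x) }
  ; mono = λ { {m , x} {n , y} (inj₁ p) → inj₁ (ℕ.<-≤-trans (ℕ.+-monoʳ-< (m *ℕ bound) (bounded x))
                 (ℕ.≤-trans (ℕ.≤-reflexive (ℕ.+-comm (m *ℕ bound) bound))
                   (ℕ.≤-trans (ℕ.*-monoˡ-≤ bound p) (ℕ.m≤m+n _ _))))
             ; {m , _} (inj₂ (refl , p)) → step {m} (mono p) }
  }
  where
  open Bounded B
  step : ∀ {m u v} → Ordinal._<_ (ω ^ᴼ suc i) u v →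
         Ordinal._<_ (ω ^ᴼ suc i) (m *ℕ bound + proj₁ u , proj₂ u) (m *ℕ bound + proj₁ v , proj₂ v)
  step {m} (inj₁ q)       = inj₁ (ℕ.+-monoʳ-< (m *ℕ bound) q)
  step {m} (inj₂ (q , r)) = inj₂ (cong (m *ℕ bound +_) q , r)

-- Replacement of an interval in its context.

Well : Lin d a → Set a
Well A = WellFounded (Lin._<_ A)

Well-∣ : {A : Lin d a} {P : Pt A → Set a} → Well A → Well (A ∣ P)
Well-∣ w = On.wellFounded proj₁ w

module Collapse (em : ∀ {ℓ : Level} → ExcludedMiddle ℓ) (d : ℕ) (p : ℕ) where

  open Types em d
  open Contexts em d
  open Powers em d

  characterIn : Lin d a → (I : Lin d b) → Lin d c → Pt I → Char p
  characterIn H I R x = encode p (color I x) (tp p (H ⊕ I ↓ x)) (tp p (I ↑ x ⊕ R))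

  module _ {a b c a′ b′ c′ : Level} {H : Lin d a} {A : Lin d b} {R : Lin d c}
           {H′ : Lin d a′} {A′ : Lin d b′} {R′ : Lin d c′} {x : Pt A} {x′ : Pt A′} where

    characterIn⇒SimilarIn : characterIn H A R x ≡ characterIn H′ A′ R′ x′ →
                          SimilarIn p p H A R H′ A′ R′ x x′
    characterIn⇒SimilarIn eq =
      let q , r , s = encode-injective p eq in similarIn q (mk≈ r) (mk≈ s)

    SimilarIn⇒characterInIn : SimilarIn p p H A R H′ A′ R′ x x′ →
                          characterIn H A R x ≡ characterIn H′ A′ R′ x′
    SimilarIn⇒characterInIn (similarIn q (mk≈ r) (mk≈ s)) =
      trans (cong (λ i → encode p i _ _) q) (cong₂ (encode p _) r s)

  cong-in : ∀ {a b c c′} {H : Lin d a} {A : Lin d b} {R : Lin d c} {R′ : Lin d c′} {x} →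
            R ≈[ p ] R′ → SimilarIn p p H A R H A R′ x x
  cong-in eq = similarIn refl ≈-refl (⊕-cong ≈-refl eq)

  infix 4 _⇝[_,_]_

  -- W can replace I between H and R: the characters of the points of H and R are preserved,
  -- and W brings no characters that I did not have.

  record _⇝[_,_]_ (I : Lin d b) (H : Lin d a) (R : Lin d c) (W : Lin d ℓ) : Set (b ⊔ ℓ) where
    field
      heads      : H ⊕ W ≈[ p ] H ⊕ I
      tails      : W ⊕ R ≈[ p ] I ⊕ R
      characters : ∀ u → ∃[ k ] SimilarIn p p H W R H I R u k
  open _⇝[_,_]_ public

  ⇝-trans : {H : Lin d a} {I : Lin d b} {R : Lin d c} {J : Lin d ℓ} {W : Lin d ℓ′} →
            I ⇝[ H , R ] J → J ⇝[ H , R ] W → I ⇝[ H , R ] W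
  ⇝-trans f g = record
    { heads      = heads g ⨾ heads f
    ; tails      = tails g ⨾ tails f
    ; characters = λ u → let v , s = characters g u ; k , t = characters f v
                         in k , SimilarIn-trans s t
    }

  ⇝-transport : ∀ {a a′ b b′ c c′} {H : Lin d a} {H′ : Lin d a′} {I : Lin d b} {I′ : Lin d b′}
                {R : Lin d c} {R′ : Lin d c′} {W : Lin d ℓ} →
                H ≈[ p ] H′ → I ≅ I′ → R ≈[ p ] R′ → I ⇝[ H , R ] W → I′ ⇝[ H′ , R′ ] W
  ⇝-transport p q r f = record
    { heads      = ⊕-cong (≈-sym p) ≈-refl ⨾ heads f ⨾ ⊕-cong p (≅⇒≈ q)
    ; tails      = ⊕-cong ≈-refl (≈-sym r) ⨾ tails f ⨾ ⊕-cong (≅⇒≈ q) r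
    ; characters = λ u →
        let k , s = characters f u
            k′ , t = _≅_.to q k
        in k′ , similarIn (trans (color-≡ᶜ s) (_≅_.color-≡ q t))
                  (⊕-cong (≈-sym p) ≈-refl ⨾ head s ⨾ ⊕-cong p (≅⇒≈ (↓-≅ q t)))
                  (⊕-cong ≈-refl (≈-sym r) ⨾ tail s ⨾ ⊕-cong (≅⇒≈ (↑-≅ q t)) r)
    }

  split-≈ : ∀ {j} {A : Lin d a} {R : Lin d b} y →
            A ↓ y ⊕ point (color A y) ⊕ A ↑ y ⊕ R ≈[ j ] A ⊕ R
  split-≈ {A = A} y = ⊕-cong ≈-refl (≈-sym (≅⇒≈ ⊕-assoc)) ⨾ ≈-sym (≅⇒≈ ⊕-assoc)
                      ⨾ ⊕-cong (≈-sym (≅⇒≈ (split-≅ A y))) ≈-refl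

  module _ {a : Level} {H I R : Lin d a} (y : Pt I) where
    private
      module I = Lin I
      R↓ : Lin d a
      R↓ = point (color I y) ⊕ I ↑ y ⊕ R
      H↑ : Lin d a
      H↑ = H ⊕ I ↓ y ⊕ point (color I y)

    -- Cutting at `y` only moves the border between interval and context; the order around `x` stays
    -- the same.
    below-character : (x : Pt (I ↓ y)) → SimilarIn p p H (I ↓ y) R↓ H I R x (proj₁ x)
    below-character (x , q) = similarIn refl
      (⊕-cong ≈-refl (≅⇒≈ (∣-∣-≅ (λ _ r → r) (λ r → I.<-trans r q , r))))
      (⊕-cong (≅⇒≈ ∣-swap-≅)
              (⊕-cong ≈-refl (⊕-cong
                (≈-sym (≅⇒≈ (∣-∣-≅ (λ _ r → r) (λ r → I.<-trans q r , r)))) ≈-refl))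
       ⨾ split-≈ {A = I ↑ x} (y , q))

    above-character : (x : Pt (I ↑ y)) → SimilarIn p p H↑ (I ↑ y) R H I R x (proj₁ x)
    above-character (x , q) = similarIn refl
      (≅⇒≈ ⊕-assoc ⨾ ⊕-cong ≈-refl (≅⇒≈ ⊕-assoc
        ⨾ ⊕-cong (≈-sym (≅⇒≈ (∣-∣-≅ (λ _ r → r) (λ r → I.<-trans r q , r))))
            (⊕-cong ≈-refl (≅⇒≈ ∣-swap-≅))
        ⨾ ≈-sym (≅⇒≈ (split-≅ (I ↓ x) (y , q)))))
      (⊕-cong (≅⇒≈ (∣-∣-≅ (λ _ r → r) (λ r → I.<-trans q r , r))) ≈-refl)

    module _ {V : Lin d ℓ} {W : Lin d ℓ′}
             (f : I ↓ y ⇝[ H , R↓ ] V) (g : I ↑ y ⇝[ H↑ , R ] W) where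
      private
        U : Lin d (ℓ ⊔ ℓ′)
        U = V ⊕ point (color I y) ⊕ W

        join-head : ∀ {z} {X : Lin d z} → H ⊕ V ⊕ point (color I y) ⊕ X ≈[ p ] H↑ ⊕ X
        join-head = ≈-sym (≅⇒≈ ⊕-assoc) ⨾ ⊕-cong (heads f) ≈-refl ⨾ ≅⇒≈ ⊕-assoc
                    ⨾ ⊕-cong ≈-refl (≈-sym (≅⇒≈ ⊕-assoc)) ⨾ ≈-sym (≅⇒≈ ⊕-assoc)

        join-tail : ∀ {z} {X : Lin d z} → (X ⊕ point (color I y) ⊕ W) ⊕ R ≈[ p ] X ⊕ R↓
        join-tail = ≅⇒≈ ⊕-assoc ⨾ ⊕-cong ≈-refl (≅⇒≈ ⊕-assoc ⨾ ⊕-cong ≈-refl (tails g))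

      join-lower : ∀ u → SimilarIn p p H U R H V R↓ (inj₁ u) u
      join-lower u = similarIn refl (⊕-cong ≈-refl (≅⇒≈ ⊕-↓ˡ))
        (⊕-cong (≅⇒≈ ⊕-↑ˡ) ≈-refl ⨾ join-tail)

      join-point : SimilarIn p p H U R H I R (inj₂ (inj₁ tt)) y
      join-point = similarIn refl
        (⊕-cong ≈-refl (≅⇒≈ ⊕-↓ʳ ⨾ ⊕-cong ≈-refl
            (≅⇒≈ ⊕-↓ˡ ⨾ ≅⇒≈ (empty-≅ {B = ∅ {a = 0ℓ}} proj₂ Level.lower))
          ⨾ ≅⇒≈ (⊕-identityʳ {b = 0ℓ})) ⨾ heads f)
        (⊕-cong (≅⇒≈ ⊕-↑ʳ ⨾ ≅⇒≈ ⊕-↑ˡ ⨾ ⊕-cong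
            (≅⇒≈ (empty-≅ {B = ∅ {a = 0ℓ}} proj₂ Level.lower)) ≈-refl
          ⨾ ≅⇒≈ (⊕-identityˡ {a = 0ℓ})) ≈-refl ⨾ tails g)

      join-upper : ∀ u → SimilarIn p p H U R H↑ W R (inj₂ (inj₂ u)) u
      join-upper u = similarIn refl
        (⊕-cong ≈-refl (≅⇒≈ ⊕-↓ʳ ⨾ ⊕-cong ≈-refl (≅⇒≈ ⊕-↓ʳ)) ⨾ join-head)
        (⊕-cong (≅⇒≈ ⊕-↑ʳ ⨾ ≅⇒≈ ⊕-↑ʳ) ≈-refl)

      -- Each half is replaced against the original other half, yet both may be replaced at once:
      -- `heads f` lets `V` stand for `I ↓ y` in the left context, and `tails g` lets `W` stand for
      -- `I ↑ y` in the right one.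
      ⇝-join : I ⇝[ H , R ] U
      ⇝-join = record
        { heads      = join-head ⨾ heads g ⨾ ≅⇒≈ ⊕-assoc
                       ⨾ ⊕-cong ≈-refl (≅⇒≈ ⊕-assoc ⨾ ≈-sym (≅⇒≈ (split-≅ I y)))
        ; tails      = join-tail ⨾ tails f ⨾ split-≈ {A = I} y
        ; characters = λ
            { (inj₁ u) → let k , s = characters f u in
                         _ , SimilarIn-trans (join-lower u) (SimilarIn-trans s (below-character k))
            ; (inj₂ (inj₁ _)) → y , join-point
            ; (inj₂ (inj₂ u)) → let k , s = characters g u in
                         _ , SimilarIn-trans (join-upper u) (SimilarIn-trans s (above-character k)) }
        }

  module _ {a b c : Level} {H : Lin d a} {I : Lin d b} {R : Lin d c} where

    Carries : List (Char p) → Set b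
    Carries T = ∀ k → characterIn H I R k ∈ T

    incomparable : ∀ {x y} → ¬ I ∋ x < y → ¬ I ∋ y < x → SimilarIn p p H I R H I R x y
    incomparable q r = similarIn (Lin.color-resp I q r)
      (⊕-cong ≈-refl (≅⇒≈ (∣-ext (λ s → I.<-≤-trans s r) (λ s → I.<-≤-trans s q))))
      (⊕-cong (≅⇒≈ (∣-ext (λ s → I.≤-<-trans q s) (λ s → I.≤-<-trans r s))) ≈-refl)
      where module I = Lin I

  _∖_ : List (Char p) → Char p → List (Char p)
  T ∖ τ = filter (λ σ → ¬? (σ Fin.≟ τ)) T

  ∖-length : ∀ {T τ n} → τ ∈ T → length T ≤ suc n → length (T ∖ τ) ≤ n
  ∖-length {T} {τ} τ∈T q = ℕ.≤-pred (ℕ.≤-trans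
    (filter-notAll (λ σ → ¬? (σ Fin.≟ τ)) T (lose τ∈T (λ ¬eq → ¬eq refl))) q)

  ∖-∈ : ∀ {T τ σ} → σ ∈ T → σ ≢ τ → σ ∈ T ∖ τ
  ∖-∈ {τ = τ} = ∈-filter⁺ (λ σ → ¬? (σ Fin.≟ τ))

  -- If y and z have the same character, cutting out the points from z up to y preserves the
  -- characters of all remaining points.

  ⇝-cut : {H I R : Lin d a} (y z : Pt I) → SimilarIn p p H I R H I R z y → ¬ I ∋ y < z →
          I ↓ y ⇝[ H , point (color I y) ⊕ I ↑ y ⊕ R ] I ↓ z
  ⇝-cut {H = H} {I} {R} y z s q = record
    { heads      = head s
    ; tails      = ⊕-cong ≈-refl R≈ ⨾ split-≈ {A = I} z ⨾ ≈-sym (split-≈ {A = I} y)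
    ; characters = λ { (x , r) → (x , Lin.<-≤-trans I r q) , SimilarIn-trans
                         (SimilarIn-trans (cong-in R≈) (below-character z (x , r)))
                         (SimilarIn-sym (below-character y (x , Lin.<-≤-trans I r q))) }
    }
    where
    R≈ : point (color I y) ⊕ I ↑ y ⊕ R ≈[ p ] point (color I z) ⊕ I ↑ z ⊕ R
    R≈ = ⊕-cong (point-cong (sym (color-≡ᶜ s))) (≈-sym (tail s))

  Collapses : ℕ → ∀ {a} (H I R : Lin d a) → Set (lsuc 0ℓ ⊔ a)
  Collapses n H I R = ∃[ W ] I ⇝[ H , R ] W × Embeds n W

  -- `T` is an upper bound for the characters and may list some that do not occur, so a subinterval,
  -- taken in its own context, inherits it.
  CollapsesAt : ℕ → ∀ a → Set (lsuc a)
  CollapsesAt n a = ∀ {H I R : Lin d a} T → length T ≤ n → Well I →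
                    Carries {H = H} {I} {R} T → Collapses n H I R

  -- Below a point one character is saved: with `z` the first occurrence of the character of `y`,
  -- everything from `z` up to `y` is cut, and no point below `z` has this character. Hence exponent
  -- `n` in spite of `suc n` characters.
  collapse-below : ∀ {n a} → CollapsesAt n a → {H I R : Lin d a} → ∀ T → length T ≤ suc n →
    Well I → Carries {H = H} {I} {R} T → ∀ y → Collapses n H (I ↓ y) (point (color I y) ⊕ I ↑ y ⊕ R)
  collapse-below collapse {H} {I} {R} T l wf f y =
    let z , eq , least = minimal em wf (λ z → characterIn H I R z ≡ characterIn H I R y) (y , refl)
        s      = characterIn⇒SimilarIn eq
        cut    = ⇝-cut {H = H} {I} {R} y z s (least refl)
        W , g , E = collapse (T ∖ characterIn H I R y) (∖-length (f y) l) (Well-∣ {A = I} wf) λ { (x , q) →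
          -- The recursive call keeps the right context of `y`, although `I ↓ z` is followed by `z`;
          -- the two contexts agree because `y` and `z` have the same character.
          let t = SimilarIn-trans (cong-in (⊕-cong (point-cong (sym (color-≡ᶜ s))) (≈-sym (tail s))))
                    (below-character {H = H} {I} {R} z (x , q))
              eq′ = SimilarIn⇒characterInIn t
          in subst (_∈ _) (sym eq′) (∖-∈ (f x) (λ eq″ → least eq″ q)) }
    in W , ⇝-trans cut g , E

-- The bound on the order type, by induction on the number of characters.

module Bounds (em : ∀ {ℓ : Level} → ExcludedMiddle ℓ) (d : ℕ) (p : ℕ) where

  open Types em d
  open Contexts em d
  open Powers em d
  open Collapse em d p

  module Walk {n a} (collapse : CollapsesAt n a) {H I R : Lin d a} (T : List (Char p))
    (l : length T ≤ suc n) (wf : Well I) (f : Carries {H = H} {I} {R} T)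
    (recurs : ∀ k c → ∃[ x ] I ∋ c < x × characterIn H I R x ≡ characterIn H I R k)
    where

    private
      module I = Lin I
      R↓ : Pt I → Lin d a
      R↓ x = point (color I x) ⊕ I ↑ x ⊕ R

    record Visits (S : List (Pt I)) (k : Pt I) : Set (lsuc 0ℓ ⊔ a) where
      field
        last     : Pt I
        last≡    : characterIn H I R last ≡ characterIn H I R k
        W        : Lin d 0ℓ
        replaces : I ↓ last ⇝[ H , R↓ last ] W
        bounded  : Bounded n W
        visits   : ∀ {s} → s ∈ S → ∃[ u ] SimilarIn p p H W (R↓ last) H I R u s

    -- To add `s`, the walk through `S` is made to stop at a point with the character of `s`. This
    -- point is kept, and the walk goes on to a later point with the character of `k`. Every gap
    -- loses a character by `collapse-below`, so the finite sum stays within a finite multiple of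
    -- ω^n.
    visit : ∀ S k → Visits S k
    visit [] k =
      let x , _ , eq = recurs k k
          W , g , E  = collapse-below collapse T l wf f x
      in record { last = x ; last≡ = eq ; W = W ; replaces = g ; bounded = Embeds⇒Bounded E
                ; visits = λ () }
    visit (s ∷ S) k = extend (visit S s)
      where
      extend : Visits S s → Visits (s ∷ S) k
      extend V with recurs k (Visits.last V)
      ... | x , y<x , eq = result (collapse-below collapse T l (Well-∣ {A = I} wf)
                                  (λ u → subst (_∈ T)
                                    (sym (SimilarIn⇒characterInIn (above-character {H = H} {I} {R} y u)))
                                    (f (proj₁ u)))
                                  (x , y<x))
        where
        open Visits V renaming (last to y; last≡ to y≡)
        y′ : Pt (I ↓ x)
        y′ = y , y<x
        H↑ : Lin d a
        H↑ = H ⊕ I ↓ y ⊕ point (color I y)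
        R″ : Lin d a
        R″ = point (color I y) ⊕ (I ↓ x) ↑ y′ ⊕ R↓ x
        R≈ : R↓ y ≈[ p ] R″
        R≈ = ⊕-cong ≈-refl (≈-sym (split-≈ {A = I ↑ y} (x , y<x))
               ⨾ ⊕-cong (≅⇒≈ ∣-swap-≅)
                   (⊕-cong ≈-refl (⊕-cong (≅⇒≈ (∣-∣-≅ (λ _ r → r) (λ r → I.<-trans y<x r , r))) ≈-refl)))
        I↓≅ : I ↓ y ≅ I ↓ x ↓ y′
        I↓≅ = ≅-sym (∣-∣-≅ (λ _ r → r) (λ r → I.<-trans r y<x , r))
        below′ : I ↓ x ↓ y′ ⇝[ H , R″ ] W
        below′ = ⇝-transport ≈-refl I↓≅ R≈ replaces
        result : Collapses n H↑ (I ↑ y ↓ (x , y<x)) (point (color I x) ⊕ I ↑ y ↑ (x , y<x) ⊕ R) →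
                 Visits (s ∷ S) k
        result (W₂ , g , E) = record
          { last     = x
          ; last≡    = eq
          ; W        = W ⊕ point (color I y) ⊕ W₂
          ; replaces = ⇝-join {H = H} {I ↓ x} {R↓ x} y′ below′ above′
          ; bounded  = Bounded-⊕ bounded (Bounded-⊕ Bounded-point (Embeds⇒Bounded E))
          ; visits   = λ
              { (here refl) → _ , SimilarIn-trans (join-point {H = H} {I ↓ x} {R↓ x} y′ below′ above′)
                  (SimilarIn-trans (below-character {H = H} {I} {R} x y′) (characterIn⇒SimilarIn y≡))
              ; (there m) → let u , t = visits m in _ ,
                  SimilarIn-trans (join-lower {H = H} {I ↓ x} {R↓ x} y′ below′ above′ u)
                    (SimilarIn-trans (cong-in (≈-sym R≈)) t) }
          }
          where
          above′ : I ↓ x ↑ y′ ⇝[ H ⊕ I ↓ x ↓ y′ ⊕ point (color I y) , R↓ x ] W₂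
          above′ = ⇝-transport
            (⊕-cong ≈-refl (⊕-cong (≅⇒≈ I↓≅) ≈-refl)) ∣-swap-≅
            (⊕-cong ≈-refl (⊕-cong (≅⇒≈ (∣-∣-≅ (λ _ r → r) (λ r → I.<-trans y<x r , r))) ≈-refl)) g

  representatives : {H I R : Lin d a} (T : List (Char p)) →
    ∃[ S ] (∀ k → characterIn H I R k ∈ T → ∃[ s ] s ∈ S × characterIn H I R s ≡ characterIn H I R k)
  representatives [] = [] , λ _ ()
  representatives {H = H} {I} {R} (τ ∷ T)
    with representatives {H = H} {I} {R} T | em {P = ∃[ s ] characterIn H I R s ≡ τ}
  ... | S , f | no ¬s = S , λ { k (here eq) → contradiction (k , eq) ¬s ; k (there m) → f k m }
  ... | S , f | yes (s , eq) = s ∷ S , λ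
    { k (here eq′) → s , here refl , trans eq (sym eq′)
    ; k (there m) → let s′ , m′ , eq′ = f k m in s′ , there m′ , eq′ }

  collapse-recurrent : ∀ {n a} → CollapsesAt n a → {H I R : Lin d a} (T : List (Char p)) →
    length T ≤ suc n → Well I → Carries {H = H} {I} {R} T →
    (∀ k c → ∃[ x ] I ∋ c < x × characterIn H I R x ≡ characterIn H I R k) → Pt I →
    Collapses (suc n) H I R
  collapse-recurrent {n} collapse {H} {I} {R} T l wf f recurs i =
    -- With the least point as start of the period nothing of `I` lies before it, so `H` itself
    -- absorbs the period.
    let x₀ , _ , least = minimal em wf (λ _ → ⊤ {0ℓ}) (i , tt)
        S , g          = representatives {H = H} {I} {R} T
    in finish x₀ (λ x → least {x} tt) S g (Walk.visit collapse T l wf f recurs S x₀)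
    where
    finish : ∀ x₀ → (∀ x → ¬ I ∋ x < x₀) → ∀ S →
      (∀ k → characterIn H I R k ∈ T → ∃[ s ] s ∈ S × characterIn H I R s ≡ characterIn H I R k) →
      Walk.Visits collapse T l wf f recurs S x₀ → Collapses (suc n) H I R
    finish x₀ least S g V = ω-power W , record
      { heads      = Pow.ω-power-heads
      ; tails      = Pow.ω-power-tail p ℕ.≤-refl
      ; characters = Pow.ω-power-characters
      } , Embeds-ω-power bounded
      where
      open Walk.Visits V
      last-similar : SimilarIn p p H I R H I R last x₀
      last-similar = characterIn⇒SimilarIn last≡
      empty : ∀ {j} → I ↓ x₀ ≈[ j ] ∅ {a = 0ℓ}
      empty = ≅⇒≈ (empty-≅ (λ { (x , q) → least x q }) Level.lower)
      -- `last` has the character of the least point, so the tail from `last` onwards is equivalent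
      -- to all of `I ⊕ R`.
      R≈ : point (color I last) ⊕ I ↑ last ⊕ R ≈[ p ] I ⊕ R
      R≈ = ⊕-cong (point-cong (color-≡ᶜ last-similar)) (tail last-similar)
           ⨾ ≈-sym (≅⇒≈ (⊕-identityˡ {a = 0ℓ})) ⨾ ⊕-cong (≈-sym empty) ≈-refl
           ⨾ split-≈ {A = I} x₀
      absorbˡ : H ⊕ W ≈[ p ] H
      absorbˡ = heads replaces ⨾ head last-similar ⨾ ⊕-cong ≈-refl empty ⨾ ≅⇒≈ (⊕-identityʳ {b = 0ℓ})
      absorbʳ : W ⊕ I ⊕ R ≈[ p ] I ⊕ R
      absorbʳ = ⊕-cong ≈-refl (≈-sym R≈) ⨾ tails replaces ⨾ split-≈ {A = I} last
      refers : ∀ u → ∃[ k ] SimilarIn p p H W (I ⊕ R) H I R u k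
      refers u =
        let k , s = characters replaces u
        in _ , SimilarIn-trans (cong-in (≈-sym R≈))
                 (SimilarIn-trans s (below-character {H = H} {I} {R} last k))
      hits : ∀ k → ∃[ u ] SimilarIn p p H W (I ⊕ R) H I R u k
      hits k =
        let s , m , eq = g k (f k)
            u , t      = visits m
        in u , SimilarIn-trans (cong-in (≈-sym R≈)) (SimilarIn-trans t (characterIn⇒SimilarIn eq))
      recursˢ : ∀ k c → ∃[ x ] I ∋ c < x × SimilarIn p p H I R H I R x k
      recursˢ k c = let x , q , eq = recurs k c in x , q , characterIn⇒SimilarIn eq
      module Pow = Power H I R W absorbˡ absorbʳ refers hits recursˢ x₀

  ∅-⇝ : {H I R : Lin d a} → ¬ Pt I → I ⇝[ H , R ] ∅ {a = 0ℓ}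
  ∅-⇝ ¬i = record
    { heads      = ⊕-cong ≈-refl (≅⇒≈ (empty-≅ Level.lower ¬i))
    ; tails      = ⊕-cong (≅⇒≈ (empty-≅ Level.lower ¬i)) ≈-refl
    ; characters = λ ()
    }

  Carries-above : {H I R : Lin d a} {T : List (Char p)} (y : Pt I) → Carries {H = H} {I} {R} T →
    Carries {H = H ⊕ I ↓ y ⊕ point (color I y)} {I ↑ y} {R} T
  Carries-above {H = H} {I} {R} {T} y f u =
    subst (_∈ T) (sym (SimilarIn⇒characterInIn (above-character {H = H} {I} {R} y u))) (f (proj₁ u))

  collapse : ∀ n {a} → CollapsesAt n a
  collapse zero [] l wf f = ∅ , ∅-⇝ (λ i → case f i of λ ()) , Embeds-∅
  collapse (suc n) {H = H} {I} {R} T l wf f =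
    go (em {P = ∃[ y ] ∃[ τ ] τ ∈ T × (∀ x → I ∋ y < x → characterIn H I R x ≢ τ)}) (em {P = Pt I})
    where
    go : Dec (∃[ y ] ∃[ τ ] τ ∈ T × (∀ x → I ∋ y < x → characterIn H I R x ≢ τ)) → Dec (Pt I) →
         Collapses (suc n) H I R
    go _ (no ¬i) = ∅ , ∅-⇝ ¬i , Embeds-∅
    go (no ¬y) (yes i) = collapse-recurrent (collapse n) T l wf f recurs i
      where
      recurs : ∀ k c → ∃[ x ] I ∋ c < x × characterIn H I R x ≡ characterIn H I R k
      recurs k c with em {P = ∃[ x ] I ∋ c < x × characterIn H I R x ≡ characterIn H I R k}
      ... | yes q = q
      ... | no ¬q = contradiction (c , characterIn H I R k , f k , λ x q eq → ¬q (x , q , eq)) ¬y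
    -- Both sides of `y` get exponent `n`: the lower one is freed of the character of `y`, the upper
    -- one never had `τ`. Two copies of ω^n with a point between them embed into ω^(n+1).
    go (yes (y , τ , m , ¬τ)) (yes _) =
      let V , g , B = collapse-below (collapse n) T l wf f y
          W , h , E = collapse n (T ∖ τ) (∖-length m l) (Well-∣ {A = I} wf) λ u →
            let eq = SimilarIn⇒characterInIn (above-character {H = H} {I} {R} y u) in
            subst (_∈ _) (sym eq) (∖-∈ (f (proj₁ u)) (¬τ (proj₁ u) (proj₂ u)))
      in _ , ⇝-join {H = H} {I} {R} y g h ,
         Embeds-⊕ (Embeds⇒Bounded B)
           (Embeds-⊕ Bounded-point (Bounded.embeds (Embeds⇒Bounded E)))

  Realises : {H I R : Lin d a} → List (Char p) → Lin d 0ℓ → Set a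
  Realises {H = H} {I} {R} S W =
    ∀ k → characterIn H I R k ∈ S → ∃[ u ] SimilarIn p p H W R H I R u k

  -- A replacement may lose characters, because cuts remove points. They are secured by keeping the
  -- first point whose character is still missing and continuing above it. The pieces below kept
  -- points have exponent `n`; only the last piece needs `suc n`.
  collapse-realising : ∀ {n m a} {H I R : Lin d a} T → length T ≤ suc n → Well I →
    Carries {H = H} {I} {R} T → ∀ S → length S ≤ m →
    ∃[ W ] I ⇝[ H , R ] W × Embeds (suc n) W × Realises {H = H} {I} {R} S W
  collapse-realising {n} {m} {H = H} {I} {R} T l wf f S lS
    with em {P = ∃[ k ] characterIn H I R k ∈ S}
  ... | no ¬k = let W , g , E = collapse (suc n) T l wf f
                in W , g , E , λ k q → contradiction (k , q) ¬k
  collapse-realising {n} {zero} T l wf f [] lS | yes (_ , ())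
  collapse-realising {n} {suc m} {H = H} {I} {R} T l wf f S lS | yes k =
    let y , y∈S , least = minimal em wf (λ k → characterIn H I R k ∈ S) k
        V , g , B     = collapse-below (collapse n) T l wf f y
        W , h , E , r = collapse-realising {n} {m} T l (Well-∣ {A = I} wf)
                          (Carries-above {H = H} {I} {R} y f)
                          (S ∖ characterIn H I R y) (∖-length y∈S lS)
    in _ , ⇝-join {H = H} {I} {R} y g h ,
       Embeds-⊕ (Embeds⇒Bounded B) (Embeds-⊕ Bounded-point E) , realise y least g h r
    where
    realise : ∀ y → (∀ {k} → characterIn H I R k ∈ S → ¬ I ∋ k < y) → ∀ {V W : Lin d 0ℓ}
      (g : I ↓ y ⇝[ H , point (color I y) ⊕ I ↑ y ⊕ R ] V)
      (h : I ↑ y ⇝[ H ⊕ I ↓ y ⊕ point (color I y) , R ] W) →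
      Realises {H = H ⊕ I ↓ y ⊕ point (color I y)} {I ↑ y} {R} (S ∖ characterIn H I R y) W →
      Realises {H = H} {I} {R} S (V ⊕ point (color I y) ⊕ W)
    realise y least g h r k k∈S
      with em {P = characterIn H I R k ≡ characterIn H I R y} | em {P = I ∋ y < k}
    ... | yes eq | _     =
      _ , SimilarIn-trans (join-point {H = H} {I} {R} y g h) (characterIn⇒SimilarIn (sym eq))
    -- By the choice of `y`, a point with a character in `S` that is not above `y` is incomparable
    -- with it and so shares its character.
    ... | no neq | no ¬q = contradiction (SimilarIn⇒characterInIn
      (incomparable {H = H} {I} {R} (least k∈S) ¬q)) neq
    ... | no neq | yes q =
      let s     = above-character {H = H} {I} {R} y (k , q)
          u , t = r (k , q) (subst (_∈ _) (sym (SimilarIn⇒characterInIn s)) (∖-∈ k∈S neq))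
      in _ , SimilarIn-trans (join-upper {H = H} {I} {R} y g h u) (SimilarIn-trans t s)

  -- Between empty contexts the characters in context are the plain ones, and realising the same
  -- `p`-characters is equivalence at rank `suc p`.
  collapse-order : ∀ {a} (A : Lin d a) → Well A → (T : List (Char p)) →
    (∀ x → chr p A x ∈ T) → ∃[ W ] A ≈[ suc p ] W × Embeds (length T) W
  collapse-order {a} A wf T f = go T refl
    where
    E₀ : Lin d a
    E₀ = ∅

    whole-similar : ∀ {b} {B : Lin d b} {x y} → SimilarIn p p E₀ B E₀ E₀ A E₀ x y → Similar p B A x y
    whole-similar s = similar (color-≡ᶜ s)
      (≈-sym (≅⇒≈ ⊕-identityˡ) ⨾ head s ⨾ ≅⇒≈ ⊕-identityˡ)
      (≈-sym (≅⇒≈ ⊕-identityʳ) ⨾ tail s ⨾ ≅⇒≈ ⊕-identityʳ)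

    character≡ : ∀ x → characterIn E₀ A E₀ x ≡ chr p A x
    character≡ x = cong₂ (encode p (color A x))
      (tp-≡ {A = E₀ ⊕ A ↓ x} {j = p} {B = A ↓ x} (≅⇒≈ ⊕-identityˡ))
      (tp-≡ {A = A ↑ x ⊕ E₀} {j = p} {B = A ↑ x} (≅⇒≈ ⊕-identityʳ))

    carries : Carries {H = E₀} {A} {E₀} T
    carries x = subst (_∈ T) (sym (character≡ x)) (f x)

    go : ∀ T′ → T′ ≡ T → ∃[ W ] A ≈[ suc p ] W × Embeds (length T′) W
    go [] refl = ∅ , ≅⇒≈ (empty-≅ (λ x → case f x of λ ()) Level.lower) , Embeds-∅
    go (τ ∷ T′) refl =
      let W , g , E , r = collapse-realising {length T′} {H = E₀} {A} {E₀} T ℕ.≤-refl wf carries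
                            T ℕ.≤-refl
      in W , back-and-forth
               (λ x → let u , s = r x (carries x) in u , Similar-sym (whole-similar s))
               (λ u → let x , s = characters g u in x , whole-similar s) , E

-- From increasing maps between well-orders to initial segments.

module Comparison (em : ∀ {ℓ : Level} → ExcludedMiddle ℓ) {a b} (α : Ordinal a) (β : Ordinal b) where

  private
    module α = Ordinal α
    module β = Ordinal β
    module αS = StrictTotalOrder α.strictTotalOrder
    module βS = StrictTotalOrder β.strictTotalOrder

  -- Sim x y: the initial segments below x and y are isomorphic.

  data Sim (x : α.Carrier) (y : β.Carrier) : Set (a ⊔ b) where
    sim : (∀ {x′} → x′ α.< x → ∃[ y′ ] y′ β.< y × Sim x′ y′) →
          (∀ {y′} → y′ β.< y → ∃[ x′ ] x′ α.< x × Sim x′ y′) → Sim x y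

  Sim-resp : ∀ {x x′ y y′} → x α.≈ x′ → y β.≈ y′ → Sim x y → Sim x′ y′
  Sim-resp p q (sim f g) = sim
    (λ r → let y′ , s , t = f (αS.<-respʳ-≈ (αS.Eq.sym p) r) in y′ , βS.<-respʳ-≈ q s , t)
    (λ r → let x′ , s , t = g (βS.<-respʳ-≈ (βS.Eq.sym q) r) in x′ , αS.<-respʳ-≈ p s , t)

  Sim-functional : ∀ {x y z} → Sim x y → Sim x z → y β.≈ z
  Sim-functional {x} {y} {z} (sim f g) (sim h k) with βS.compare y z
  ... | tri≈ _ p _ = p
  ... | tri< p _ _ =
    let x′ , q , s = k p ; y′ , r , t = f q
    in contradiction r (βS.irrefl (Sim-functional t s))
  ... | tri> _ _ p =
    let x′ , q , s = g p ; y′ , r , t = h q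
    in contradiction r (βS.irrefl (Sim-functional t s))

  module _ (f : α.Carrier → β.Carrier) (mono : ∀ {x y} → x α.< y → f x β.< f y) where

    -- A point goes to the least strict upper bound of the ranks of its predecessors. Such a bound
    -- exists because ranks never exceed `f`; the middle component carries this invariant.
    rank : ∀ {x} → Acc α._<_ x → ∃[ y ] ¬ f x β.< y × Sim x y
    rank {x} (acc rs) =
      let y , above , min = minimal em β.<-wellFounded (λ z → ∀ {x′} (p : x′ α.< x) → proj₁ (rank (rs p)) β.< z)
                              (f x , below-f)
      in y , min below-f , sim (λ p → _ , above p , proj₂ (proj₂ (rank (rs p)))) (λ q → hit (λ P → min P q))
      where
      below-f : ∀ {x′} (p : x′ α.< x) → proj₁ (rank (rs p)) β.< f x
      below-f {x′} p with rank (rs p)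
      ... | y , q , _ with βS.compare y (f x′)
      ...   | tri< r _ _ = βS.trans r (mono p)
      ...   | tri≈ _ r _ = βS.<-respˡ-≈ (βS.Eq.sym r) (mono p)
      ...   | tri> _ _ r = contradiction r q
      -- A `z` below the least bound is no bound, so some rank is at or above it. If that rank is
      -- strictly above, its `Sim` already contains a partner for `z` further down.
      hit : ∀ {z} → ¬ (∀ {x′} (p : x′ α.< x) → proj₁ (rank (rs p)) β.< z) →
            ∃[ x′ ] x′ α.< x × Sim x′ z
      hit {z} ¬above with em {P = ∃[ x′ ] Σ[ p ∈ x′ α.< x ] ¬ proj₁ (rank (rs p)) β.< z}
      ... | no ¬p = contradiction (λ {x′} p → above p (em {P = proj₁ (rank (rs p)) β.< z})) ¬above
        where
        above : ∀ {x′} (p : x′ α.< x) → Dec (proj₁ (rank (rs p)) β.< z) → proj₁ (rank (rs p)) β.< z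
        above p (yes q) = q
        above p (no ¬q) = contradiction (_ , p , ¬q) ¬p
      ... | yes (x′ , p , ¬q) with rank (rs p)
      ...   | y , _ , s with βS.compare y z
      ...     | tri< q _ _ = contradiction q ¬q
      ...     | tri≈ _ q _ = x′ , p , Sim-resp αS.Eq.refl q s
      ...     | tri> _ _ q = let x″ , r , t = below-sim s q in x″ , αS.trans r p , t
        where
        below-sim : ∀ {x y z} → Sim x y → z β.< y → ∃[ x″ ] x″ α.< x × Sim x″ z
        below-sim (sim _ g) = g

    monotone⇒≼ : α ≼ β
    monotone⇒≼ = record
      { to      = to
      ; to-cong = λ p → Sim-functional (Sim-resp p βS.Eq.refl (to-sim _)) (to-sim _)
      ; to-mono = λ {x} {y} p → mono′ p (to-sim y)
      ; initial = λ {x} q → initial (to-sim x) q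
      }
      where
      to : α.Carrier → β.Carrier
      to x = proj₁ (rank (α.<-wellFounded x))
      to-sim : ∀ x → Sim x (to x)
      to-sim x = proj₂ (proj₂ (rank (α.<-wellFounded x)))
      mono′ : ∀ {x y z} → x α.< y → Sim y z → to x β.< z
      mono′ p (sim f _) = let _ , q , s = f p in βS.<-respˡ-≈ (Sim-functional s (to-sim _)) q
      initial : ∀ {x y z} → Sim x y → z β.< y → ∃[ x′ ] to x′ β.≈ z
      initial (sim _ g) q = let x′ , _ , s = g q in x′ , Sim-functional (to-sim x′) s

-- Colored ordinals as orders, and the game for first-order sentences.

module _ (𝔄 : ColoredOrdinal d a) where
  private
    module 𝔄  = ColoredOrdinal 𝔄
    module 𝔄S = StrictTotalOrder 𝔄.strictTotalOrder

  incomparable⇒≈ : ∀ {x y} → ¬ x 𝔄.< y → ¬ y 𝔄.< x → x 𝔄.≈ y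
  incomparable⇒≈ {x} {y} p q with 𝔄S.compare x y
  ... | tri< r _ _ = contradiction r p
  ... | tri≈ _ r _ = r
  ... | tri> _ _ r = contradiction r q

  lin : Lin d a
  lin = record
    { Pt         = 𝔄.Carrier
    ; _<_        = 𝔄._<_
    ; color      = 𝔄.color
    ; asym       = 𝔄S.asym
    ; cotrans    = cotrans
    ; color-resp = λ {x} {y} p q →
        𝔄.disjoint (𝔄.C-resp _ (incomparable⇒≈ p q) (proj₂ (𝔄.cover x))) (proj₂ (𝔄.cover y))
    }
    where
    cotrans : ∀ {x y} z → x 𝔄.< y → x 𝔄.< z ⊎ z 𝔄.< y
    cotrans {x} z p with 𝔄S.compare x z
    ... | tri< q _ _ = inj₁ q
    ... | tri≈ _ q _ = inj₂ (𝔄S.<-respˡ-≈ q p)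
    ... | tri> _ _ q = inj₂ (𝔄S.trans q p)

lin-↾< : (𝔄 : ColoredOrdinal d a) → ∀ x → lin (𝔄 ↾< x) ≅ lin 𝔄 ↓ x
lin-↾< 𝔄 x = record
  { _~_ = λ y z → proj₁ y ≡ proj₁ z ; to = λ y → y , refl ; from = λ y → y , refl
  ; color-≡ = λ { refl → refl } ; to-< = λ { refl refl p → p } ; from-< = λ { refl refl p → p }
  }

lin-↾> : (𝔄 : ColoredOrdinal d a) → ∀ x → lin (𝔄 ↾> x) ≅ lin 𝔄 ↑ x
lin-↾> 𝔄 x = record
  { _~_ = λ y z → proj₁ y ≡ proj₁ z ; to = λ y → y , refl ; from = λ y → y , refl
  ; color-≡ = λ { refl → refl } ; to-< = λ { refl refl p → p } ; from-< = λ { refl refl p → p }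
  }

module Logic (em : ∀ {ℓ : Level} → ExcludedMiddle ℓ) (d : ℕ) where

  open Types em d

  -- A position of the Ehrenfeucht–Fraïssé game with j rounds to go: the pebbles played so far
  -- split both orders, recursively, into pairs of j-equivalent intervals.

  data Position (j : ℕ) (A : Lin d a) (B : Lin d b) : Set (a ⊔ b) where
    leaf : A ≈[ j ] B → Position j A B
    node : ∀ x y → color A x ≡ color B y → Position j (A ↓ x) (B ↓ y) →
           Position j (A ↑ x) (B ↑ y) → Position j A B

  -- `here` accepts every point incomparable with the pebble, so a move onto an old pebble needs no
  -- new node.
  data Matched {a b j} {A : Lin d a} {B : Lin d b} : Position j A B → Pt A → Pt B → Set (a ⊔ b) where
    here  : ∀ {x y eq l r u v} → ¬ A ∋ u < x → ¬ A ∋ x < u → ¬ B ∋ v < y → ¬ B ∋ y < v →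
            Matched (node x y eq l r) u v
    lower : ∀ {x y eq l r} {u : Pt (A ↓ x)} {v : Pt (B ↓ y)} →
            Matched l u v → Matched (node x y eq l r) (proj₁ u) (proj₁ v)
    upper : ∀ {x y eq l r} {u : Pt (A ↑ x)} {v : Pt (B ↑ y)} →
            Matched r u v → Matched (node x y eq l r) (proj₁ u) (proj₁ v)

  mirror : {A : Lin d a} {B : Lin d b} → Position j A B → Position j B A
  mirror (leaf p)         = leaf (≈-sym p)
  mirror (node x y p l r) = node y x (sym p) (mirror l) (mirror r)

  Matched-mirror : {A : Lin d a} {B : Lin d b} {t : Position j A B} {u : Pt A} {v : Pt B} →
                 Matched t u v → Matched (mirror t) v u
  Matched-mirror (here p q r s) = here r s p q
  Matched-mirror (lower m)      = lower (Matched-mirror m)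
  Matched-mirror (upper m)      = upper (Matched-mirror m)

  weaken : {A : Lin d a} {B : Lin d b} → Position (suc j) A B → Position j A B
  weaken (leaf p)         = leaf (≈-pred p)
  weaken (node x y p l r) = node x y p (weaken l) (weaken r)

  Matched-weaken : {A : Lin d a} {B : Lin d b} {t : Position (suc j) A B} {u : Pt A} {v : Pt B} →
                   Matched t u v → Matched (weaken t) u v
  Matched-weaken (here p q r s) = here p q r s
  Matched-weaken (lower m)      = lower (Matched-weaken m)
  Matched-weaken (upper m)      = upper (Matched-weaken m)

  Matched-color : {A : Lin d a} {B : Lin d b} {t : Position j A B} {u : Pt A} {v : Pt B} →
                  Matched t u v → color A u ≡ color B v
  Matched-color {A = A} {B} (here {eq = eq} p q r s) =
    trans (Lin.color-resp A p q) (trans eq (sym (Lin.color-resp B r s)))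
  Matched-color (lower m) = Matched-color m
  Matched-color (upper m) = Matched-color m

  Matched-< : {A : Lin d a} {B : Lin d b} {t : Position j A B} {u u′ : Pt A} {v v′ : Pt B} →
              Matched t u v → Matched t u′ v′ → A ∋ u < u′ → B ∋ v < v′
  Matched-< {A = A} (here p q _ _) (here p′ q′ _ _) u< =
    contradiction (Lin.≤-<-trans A p u<) q′
  Matched-< {A = A} (here p q r s) (lower {u = _ , x<} m) u< =
    contradiction (Lin.<-trans A u< x<) p
  Matched-< {B = B} (here p q r s) (upper {v = _ , <y} m) u< = Lin.≤-<-trans B s <y
  Matched-< {B = B} (lower {v = _ , v<} m) (here _ _ r _) _ = Lin.<-≤-trans B v< r
  Matched-< (lower m) (lower m′) u< = Matched-< m m′ u<
  Matched-< {B = B} (lower {v = _ , v<} m) (upper {v = _ , <v} _) _ = Lin.<-trans B v< <v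
  Matched-< {A = A} (upper {u = _ , <u} m) (here p q _ _) u< =
    contradiction (Lin.<-trans A <u u<) q
  Matched-< {A = A} (upper {u = _ , <u} m) (lower {u = _ , u′<} _) u< =
    contradiction (Lin.<-trans A <u u<) (Lin.asym A u′<)
  Matched-< (upper m) (upper m′) u< = Matched-< m m′ u<

  record Extension {j} {A : Lin d a} {B : Lin d b} (t : Position (suc j) A B) (x : Pt A) :
                   Set (a ⊔ b) where
    field
      position : Position j A B
      reply    : Pt B
      new      : Matched position x reply
      old      : ∀ {u v} → Matched t u v → Matched position u v

  extend : {A : Lin d a} {B : Lin d b} (t : Position (suc j) A B) (x : Pt A) → Extension t x
  extend {A = A} {B} (leaf p) x =
    let y , s = forth p x
    in record
      { position = node x y (color-≡ s) (leaf (below s)) (leaf (above s))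
      ; reply    = y
      ; new      = here (Lin.irrefl A) (Lin.irrefl A) (Lin.irrefl B) (Lin.irrefl B)
      ; old      = λ ()
      }
  extend {A = A} {B} (node x₀ y₀ eq l r) x with em {P = A ∋ x < x₀} | em {P = A ∋ x₀ < x}
  ... | yes p | _ = record
    { position = node x₀ y₀ eq (Extension.position e) (weaken r)
    ; reply    = proj₁ (Extension.reply e)
    ; new      = lower (Extension.new e)
    ; old      = λ { (here p q r s) → here p q r s ; (lower m) → lower (Extension.old e m)
                   ; (upper m) → upper (Matched-weaken m) }
    }
    where e = extend l (x , p)
  ... | no _ | yes p = record
    { position = node x₀ y₀ eq (weaken l) (Extension.position e)
    ; reply    = proj₁ (Extension.reply e)
    ; new      = upper (Extension.new e)
    ; old      = λ { (here p q r s) → here p q r s ; (lower m) → lower (Matched-weaken m)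
                   ; (upper m) → upper (Extension.old e m) }
    }
    where e = extend r (x , p)
  ... | no p | no q = record
    { position = weaken (node x₀ y₀ eq l r)
    ; reply    = y₀
    ; new      = here p q (Lin.irrefl B) (Lin.irrefl B)
    ; old      = Matched-weaken
    }

  Sat-transfer : {𝔄 : ColoredOrdinal d a} {𝔅 : ColoredOrdinal d b}
    (t : Position j (lin 𝔄) (lin 𝔅)) (φ : Formula d n) → qr φ ≤ j →
    {v : Vector (ColoredOrdinal.Carrier 𝔄) n} {w : Vector (ColoredOrdinal.Carrier 𝔅) n} →
    (∀ i → Matched t (v i) (w i)) → Sat 𝔄 v φ → Sat 𝔅 w φ
  -- Equality in 𝔅 is incomparability, and a strict inequality there would be carried back by the
  -- mirrored position.
  Sat-transfer {𝔄 = 𝔄} {𝔅} t (x ≐ y) _ m s = incomparable⇒≈ 𝔅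
    (λ p → 𝔄S.irrefl s (Matched-< (Matched-mirror (m x)) (Matched-mirror (m y)) p))
    (λ p → 𝔄S.irrefl (𝔄S.Eq.sym s) (Matched-< (Matched-mirror (m y)) (Matched-mirror (m x)) p))
    where module 𝔄S = StrictTotalOrder (ColoredOrdinal.strictTotalOrder 𝔄)
  Sat-transfer t (x ≺ y) _ m s = Matched-< (m x) (m y) s
  Sat-transfer {𝔄 = 𝔄} {𝔅} t (col i x) _ m s =
    subst (λ i → ColoredOrdinal.C 𝔅 i _) (trans (sym (Matched-color (m x)))
      (ColoredOrdinal.disjoint 𝔄 (proj₂ (ColoredOrdinal.cover 𝔄 _)) s))
      (proj₂ (ColoredOrdinal.cover 𝔅 _))
  Sat-transfer t (¬′ φ) l m s = λ s′ → s (Sat-transfer (mirror t) φ l (Matched-mirror ∘ m) s′)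
  Sat-transfer t (φ ∧′ ψ) l m (s , s′) =
    Sat-transfer t φ (ℕ.m⊔n≤o⇒m≤o (qr φ) (qr ψ) l) m s ,
    Sat-transfer t ψ (ℕ.m⊔n≤o⇒n≤o (qr φ) (qr ψ) l) m s′
  Sat-transfer t (φ ∨′ ψ) l m (inj₁ s) = inj₁ (Sat-transfer t φ (ℕ.m⊔n≤o⇒m≤o (qr φ) (qr ψ) l) m s)
  Sat-transfer t (φ ∨′ ψ) l m (inj₂ s) = inj₂ (Sat-transfer t ψ (ℕ.m⊔n≤o⇒n≤o (qr φ) (qr ψ) l) m s)
  Sat-transfer t (∃′ φ) (s≤s l) m (x , s) =
    reply , Sat-transfer position φ l (λ { zero → new ; (suc i) → old (m i) }) s
    where open Extension (extend t x)
  Sat-transfer t (∀′ φ) (s≤s l) m s y =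
    Sat-transfer (mirror position) φ l
      (λ { zero → Matched-mirror new ; (suc i) → Matched-mirror (old (Matched-mirror (m i))) }) (s reply)
    where open Extension (extend (mirror t) y)

  ≈⇒≡ : {𝔄 : ColoredOrdinal d a} {𝔅 : ColoredOrdinal d b} → lin 𝔄 ≈[ j ] lin 𝔅 → 𝔄 ≡[ j ] 𝔅
  ≈⇒≡ p φ l = mk⇔ (Sat-transfer (leaf p) φ l λ ()) (Sat-transfer (leaf (≈-sym p)) φ l λ ())

-- Types are definable by formulas of the same rank.

module Definability (em : ∀ {ℓ : Level} → ExcludedMiddle ℓ) (d : ℕ) where

  open Types em d

  -- With no variable in scope there is no atomic formula, so this truth costs a quantifier. This
  -- accounts for `1 ≤ j + n` in `has-type-qr`.
  tautology : ∀ n → Formula d n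
  tautology zero    = ∀′ (zero ≐ zero)
  tautology (suc n) = zero ≐ zero

  conjunction : ∀ m → (Fin m → Formula d n) → Formula d n
  conjunction zero    f = ∀′ (zero ≐ zero)
  conjunction (suc m) f = f zero ∧′ conjunction m (f ∘ suc)

  literal : Fin 2 → Formula d n → Formula d n
  literal zero    φ = ¬′ φ
  literal (suc _) φ = φ

  after-bound before-bound : Maybe (Fin n) → Formula d (suc n)
  after-bound nothing   = zero ≐ zero
  after-bound (just c)  = suc c ≺ zero
  before-bound nothing  = zero ≐ zero
  before-bound (just c) = zero ≺ suc c

  decode : ∀ j → Char j → Fin d × Type j × Type j
  decode j k = let i , r = remQuot {d} (#type j *ℕ #type j) k in i , remQuot {#type j} (#type j) r

  encode-decode : ∀ j k → encode j (proj₁ (decode j k)) (proj₁ (proj₂ (decode j k)))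
                                   (proj₂ (proj₂ (decode j k))) ≡ k
  encode-decode j k =
    trans (cong (combine (proj₁ (remQuot {d} (#type j *ℕ #type j) k))) (combine-remQuot {#type j} (#type j) (proj₂ (remQuot {d} (#type j *ℕ #type j) k))))
          (combine-remQuot {d} (#type j *ℕ #type j) k)

  -- Hintikka formulas: the type, respectively an occurrence of the character, of the
  -- interval between two variables.

  has-type      : ∀ j {n} → Maybe (Fin n) → Maybe (Fin n) → Type j → Formula d n
  has-character : ∀ j {n} → Maybe (Fin n) → Maybe (Fin n) → Char j → Formula d n
  has-type zero    {n} lo hi t = tautology n
  has-type (suc j) lo hi t =
    conjunction (#char j) (λ k → literal (finToFun t k) (has-character j lo hi k))
  has-character j lo hi k =
    let i , s , t = decode j k in
    ∃′ ((after-bound lo ∧′ before-bound hi) ∧′ (col i zero ∧′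
        (has-type j (Maybe.map suc lo) (just zero) s ∧′ has-type j (just zero) (Maybe.map suc hi) t)))

  conjunction-qr : ∀ {l} m {f : Fin m → Formula d n} → (∀ k → qr (f k) ≤ suc l) →
                   qr (conjunction m f) ≤ suc l
  conjunction-qr zero    q = s≤s z≤n
  conjunction-qr (suc m) q = ℕ.⊔-lub (q zero) (conjunction-qr m (q ∘ suc))

  literal-qr : ∀ (b : Fin 2) {φ : Formula d n} {l} → qr φ ≤ l → qr (literal b φ) ≤ l
  literal-qr zero    q = q
  literal-qr (suc _) q = q

  bound-qr : ∀ (lo hi : Maybe (Fin n)) {l} → qr (after-bound lo ∧′ before-bound hi) ≤ l
  bound-qr nothing  nothing  = z≤n
  bound-qr nothing  (just _) = z≤n
  bound-qr (just _) nothing  = z≤n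
  bound-qr (just _) (just _) = z≤n

  has-type-qr : ∀ j {n} (lo hi : Maybe (Fin n)) t → 1 ≤ j + n → qr (has-type j lo hi t) ≤ j
  has-type-qr zero {suc n} lo hi t _ = z≤n
  has-type-qr (suc j) {n} lo hi t _ = conjunction-qr (#char j) λ k →
    literal-qr (finToFun t k) (s≤s (ℕ.⊔-lub (bound-qr lo hi) (ℕ.⊔-lub z≤n (ℕ.⊔-lub
      (has-type-qr j _ _ _ 1≤) (has-type-qr j _ _ _ 1≤)))))
    where
    1≤ : 1 ≤ j + suc n
    1≤ = ℕ.≤-trans (s≤s z≤n) (ℕ.m≤n+m (suc n) j)

  module _ (𝔄 : ColoredOrdinal d a) where
    private
      module 𝔄  = ColoredOrdinal 𝔄
      module 𝔄S = StrictTotalOrder 𝔄.strictTotalOrder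

    afterᵛ beforeᵛ : Vector 𝔄.Carrier n → Maybe (Fin n) → 𝔄.Carrier → Set a
    afterᵛ  v nothing  x = ⊤
    afterᵛ  v (just c) x = v c 𝔄.< x
    beforeᵛ v nothing  x = ⊤
    beforeᵛ v (just c) x = x 𝔄.< v c

    interval : Vector 𝔄.Carrier n → Maybe (Fin n) → Maybe (Fin n) → Lin d a
    interval v lo hi = lin 𝔄 ∣ (λ x → afterᵛ v lo x × beforeᵛ v hi x)

    private
      variable
        v : Vector 𝔄.Carrier n
        x y : 𝔄.Carrier

    conjunction⁺ : ∀ m {f : Fin m → Formula d n} → (∀ k → Sat 𝔄 v (f k)) → Sat 𝔄 v (conjunction m f)
    conjunction⁺ zero    s = λ _ → 𝔄S.Eq.refl
    conjunction⁺ (suc m) s = s zero , conjunction⁺ m (s ∘ suc)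

    conjunction⁻ : ∀ m {f : Fin m → Formula d n} → Sat 𝔄 v (conjunction m f) → ∀ k → Sat 𝔄 v (f k)
    conjunction⁻ (suc m) (s , _)  zero    = s
    conjunction⁻ (suc m) (_ , s′) (suc k) = conjunction⁻ m s′ k

    tautology⁺ : ∀ n {v : Vector 𝔄.Carrier n} → Sat 𝔄 v (tautology n)
    tautology⁺ zero    = λ _ → 𝔄S.Eq.refl
    tautology⁺ (suc n) = 𝔄S.Eq.refl

    after⁺ : ∀ lo → afterᵛ v lo x → Sat 𝔄 (x ∷ᵛ v) (after-bound lo)
    after⁺ nothing  _ = 𝔄S.Eq.refl
    after⁺ (just _) p = p

    after⁻ : ∀ lo → Sat 𝔄 (x ∷ᵛ v) (after-bound lo) → afterᵛ v lo x
    after⁻ nothing  _ = tt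
    after⁻ (just _) p = p

    before⁺ : ∀ hi → beforeᵛ v hi x → Sat 𝔄 (x ∷ᵛ v) (before-bound hi)
    before⁺ nothing  _ = 𝔄S.Eq.refl
    before⁺ (just _) p = p

    before⁻ : ∀ hi → Sat 𝔄 (x ∷ᵛ v) (before-bound hi) → beforeᵛ v hi x
    before⁻ nothing  _ = tt
    before⁻ (just _) p = p

    after-suc⁺ : ∀ lo → afterᵛ v lo y → afterᵛ (x ∷ᵛ v) (Maybe.map suc lo) y
    after-suc⁺ nothing  _ = tt
    after-suc⁺ (just _) p = p

    after-suc⁻ : ∀ lo → afterᵛ (x ∷ᵛ v) (Maybe.map suc lo) y → afterᵛ v lo y
    after-suc⁻ nothing  _ = tt
    after-suc⁻ (just _) p = p

    before-suc⁺ : ∀ hi → beforeᵛ v hi y → beforeᵛ (x ∷ᵛ v) (Maybe.map suc hi) y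
    before-suc⁺ nothing  _ = tt
    before-suc⁺ (just _) p = p

    before-suc⁻ : ∀ hi → beforeᵛ (x ∷ᵛ v) (Maybe.map suc hi) y → beforeᵛ v hi y
    before-suc⁻ nothing  _ = tt
    before-suc⁻ (just _) p = p

    after-trans : ∀ lo → afterᵛ v lo x → x 𝔄.< y → afterᵛ v lo y
    after-trans nothing  _ _ = tt
    after-trans (just _) p q = 𝔄S.trans p q

    before-trans : ∀ hi → beforeᵛ v hi x → y 𝔄.< x → beforeᵛ v hi y
    before-trans nothing  _ _ = tt
    before-trans (just _) p q = 𝔄S.trans q p

    interval-↓ : ∀ lo hi (p : afterᵛ v lo x × beforeᵛ v hi x) →
                 interval v lo hi ↓ (x , p) ≅ interval (x ∷ᵛ v) (Maybe.map suc lo) (just zero)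
    interval-↓ lo hi p = ∣-∣-≅
      (λ { (q , _) r → after-suc⁺ lo q , r })
      (λ { (q , r) → (after-suc⁻ lo q , before-trans hi (proj₂ p) r) , r })

    interval-↑ : ∀ lo hi (p : afterᵛ v lo x × beforeᵛ v hi x) →
                 interval v lo hi ↑ (x , p) ≅ interval (x ∷ᵛ v) (just zero) (Maybe.map suc hi)
    interval-↑ lo hi p = ∣-∣-≅
      (λ { (_ , q) r → r , before-suc⁺ hi q })
      (λ { (r , q) → (after-trans lo (proj₁ p) r , before-suc⁻ hi q) , r })

    -- Soundness and completeness go by one recursion, since a negated literal in either direction
    -- calls on the other.
    has-type⁺ : ∀ {n} {v : Vector 𝔄.Carrier n} j lo hi {t} → tp j (interval v lo hi) ≡ t → Sat 𝔄 v (has-type j lo hi t)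
    has-type⁻ : ∀ j lo hi {t} → Sat 𝔄 v (has-type j lo hi t) → tp j (interval v lo hi) ≡ t
    has-character⁺ : ∀ j lo hi {k} → ∃[ x ] chr j (interval v lo hi) x ≡ k →
                     Sat 𝔄 v (has-character j lo hi k)
    has-character⁻ : ∀ j lo hi {k} → Sat 𝔄 v (has-character j lo hi k) →
                     ∃[ x ] chr j (interval v lo hi) x ≡ k

    has-type⁺ {n} zero lo hi refl = tautology⁺ n
    has-type⁺ {v = v} (suc j) lo hi refl = conjunction⁺ (#char j) λ k → lit k _ (realises j _ k)
      where
      lit : ∀ k b → b ≡ truth (∃[ x ] chr j (interval v lo hi) x ≡ k) →
            Sat 𝔄 v (literal b (has-character j lo hi k))
      lit k zero eq s =
        contradiction (trans eq (truth-yes (has-character⁻ j lo hi s))) λ ()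
      lit k (suc zero) eq = has-character⁺ j lo hi (truth-elim (sym eq))

    has-type⁻ zero    lo hi {zero} _ = refl
    has-type⁻ {v = v} (suc j) lo hi {t} s =
      trans (funToFin-cong {m = #char j} λ k → sym (lit k (finToFun t k) (conjunction⁻ (#char j) s k)))
            (funToFin-finToFin {#char j} t)
      where
      lit : ∀ k b → Sat 𝔄 v (literal b (has-character j lo hi k)) →
            b ≡ truth (∃[ x ] chr j (interval v lo hi) x ≡ k)
      lit k zero       s = sym (truth-no (λ c → s (has-character⁺ j lo hi c)))
      lit k (suc zero) s = sym (truth-yes (has-character⁻ j lo hi s))

    has-character⁺ {v = v} j lo hi {k} ((x , p) , eq) =
      let q , r , s = encode-injective j (trans eq (sym (encode-decode j k)))
      in x , (after⁺ lo (proj₁ p) , before⁺ hi (proj₂ p)) ,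
         subst (λ i → 𝔄.C i x) q (proj₂ (𝔄.cover x)) ,
         has-type⁺ j _ _ (trans (sym (tp-≡ (≅⇒≈ {j = j} (interval-↓ lo hi p)))) r) ,
         has-type⁺ j _ _ (trans (sym (tp-≡ (≅⇒≈ {j = j} (interval-↑ lo hi p)))) s)

    has-character⁻ {v = v} j lo hi {k} (x , (p , q) , c , s , t) =
      (x , r) , trans (trans
        (cong (λ i → encode j i (tp j (interval v lo hi ↓ (x , r))) (tp j (interval v lo hi ↑ (x , r))))
          (𝔄.disjoint (proj₂ (𝔄.cover x)) c))
        (cong₂ (encode j _)
          (trans (tp-≡ (≅⇒≈ {j = j} (interval-↓ lo hi r))) (has-type⁻ j _ _ s))
          (trans (tp-≡ (≅⇒≈ {j = j} (interval-↑ lo hi r))) (has-type⁻ j _ _ t))))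
        (encode-decode j k)
      where
      r : afterᵛ v lo x × beforeᵛ v hi x
      r = after⁻ lo p , before⁻ hi q

  -- The sentence that describes the `j`-type of 𝔄 also holds in 𝔅. This makes the count of
  -- characters exact: different codes stay different up to `≡[ j ]`.
  ≡⇒≈ : {𝔄 : ColoredOrdinal d a} {𝔅 : ColoredOrdinal d b} → 1 ≤ j →
        𝔄 ≡[ j ] 𝔅 → lin 𝔄 ≈[ j ] lin 𝔅
  ≡⇒≈ {j = j} {𝔄 = 𝔄} {𝔅} 1≤j eq =
    ≈-sym (≅⇒≈ (∣-true-≅ (λ _ → tt , tt))) ⨾ mk≈ (sym B≡A) ⨾ ≅⇒≈ (∣-true-≅ (λ _ → tt , tt))
    where
    t : Type j
    t = tp j (interval 𝔄 []ᵛ nothing nothing)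
    B≡A : tp j (interval 𝔅 []ᵛ nothing nothing) ≡ t
    B≡A = has-type⁻ 𝔅 j nothing nothing (Equivalence.to
      (eq (has-type j nothing nothing t)
          (has-type-qr j nothing nothing t (ℕ.≤-trans 1≤j (ℕ.m≤m+n j 0))))
      (has-type⁺ 𝔄 j nothing nothing refl))

-- Counting the characters and building the ordinal.

lookup-injective : {A : Set a} {xs : List A} → Unique xs → ∀ i j →
                   lookup xs i ≡ lookup xs j → i ≡ j
lookup-injective (_ ∷ _)  zero    zero    _  = refl
lookup-injective (p ∷ _)  zero    (suc j) eq = contradiction eq (All.lookup p (∈-lookup j))
lookup-injective (p ∷ _)  (suc i) zero    eq = contradiction (sym eq) (All.lookup p (∈-lookup i))
lookup-injective (_ ∷ ps) (suc i) (suc j) eq = cong suc (lookup-injective ps i j eq)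

module Realisation (em : ∀ {ℓ : Level} → ExcludedMiddle ℓ) (d : ℕ) where

  open Types em d
  open Logic em d
  open Definability em d

  module _ (W : Lin d 0ℓ) {k : ℕ} (E : Embeds k W) where
    private
      module W = Lin W

    -- Incomparability becomes the equality that `Lin` leaves out, and well-foundedness is pulled
    -- back along the embedding into ω^k.
    ordinal : Ordinal 0ℓ
    ordinal = record
      { strictTotalOrder = record
        { Carrier            = W.Pt
        ; _≈_                = λ x y → ¬ x W.< y × ¬ y W.< x
        ; _<_                = W._<_
        ; isStrictTotalOrder = record
          { isStrictPartialOrder = record
            { isEquivalence = record
              { refl  = W.irrefl , W.irrefl
              ; sym   = λ { (p , q) → q , p }
              ; trans = λ { (p , q) (p′ , q′) →
                  (λ r → p′ (W.≤-<-trans p r)) , (λ r → q′ (W.<-≤-trans r q)) }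
              }
            ; irrefl        = λ { (p , _) q → p q }
            ; trans         = W.<-trans
            ; <-resp-≈      = (λ { (p , q) r → W.<-≤-trans r q }) , (λ { (p , q) r → W.≤-<-trans p r })
            }
          ; compare = compare
          }
        }
      ; <-wellFounded = WF.Subrelation.wellFounded (Embeds.mono E)
                          (On.wellFounded (Embeds.map E) (Ordinal.<-wellFounded (ω ^ᴼ k)))
      }
      where
      compare : ∀ x y → Tri (x W.< y) (¬ x W.< y × ¬ y W.< x) (y W.< x)
      compare x y with em {P = x W.< y} | em {P = y W.< x}
      ... | yes p | _     = tri< p (λ q → proj₁ q p) (W.asym p)
      ... | no ¬p | yes q = tri> ¬p (λ r → proj₂ r q) q
      ... | no ¬p | no ¬q = tri≈ ¬p (¬p , ¬q) ¬q

    coloredOrdinal : ColoredOrdinal d 0ℓ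
    coloredOrdinal = record
      { otp      = ordinal
      ; C        = λ i x → W.color x ≡ i
      ; C-resp   = λ i p q → trans (sym (W.color-resp (proj₁ p) (proj₂ p))) q
      ; cover    = λ x → W.color x , refl
      ; disjoint = λ { refl q → q }
      }

    lin-coloredOrdinal : lin coloredOrdinal ≅ W
    lin-coloredOrdinal = record
      { _~_ = _≡_ ; to = λ y → y , refl ; from = λ y → y , refl
      ; color-≡ = λ { refl → refl } ; to-< = λ { refl refl p → p } ; from-< = λ { refl refl p → p }
      }

    ordinal-≼ : ordinal ≼ ω ^ᴼ k
    ordinal-≼ = Comparison.monotone⇒≼ em ordinal (ω ^ᴼ k) (Embeds.map E) (Embeds.mono E)

  module _ {a} (𝔄 : ColoredOrdinal d a) (p : ℕ) (1≤p : 1 ≤ p) where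
    private
      module 𝔄 = ColoredOrdinal 𝔄

    -- There are finitely many codes, so the realised ones can be listed without repetition; the
    -- length of this list is the `k` of the theorem.
    realised : List (Char p)
    realised = filter (λ k → em {P = ∃[ x ] chr p (lin 𝔄) x ≡ k}) (allFin (#char p))

    chr∈realised : ∀ x → chr p (lin 𝔄) x ∈ realised
    chr∈realised x = ∈-filter⁺ (λ k → em {P = ∃[ x ] chr p (lin 𝔄) x ≡ k}) (∈-allFin _) (x , refl)

    point-of : ∀ i → ∃[ x ] chr p (lin 𝔄) x ≡ lookup realised i
    point-of i = proj₂ (∈-filter⁻ (λ k → em {P = ∃[ x ] chr p (lin 𝔄) x ≡ k})
                         {xs = allFin (#char p)} (∈-lookup i))

    private
      module Ch = Setoid (Character d a p)
      open Ch using () renaming (_≈_ to _≈ᶜ_)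

    chr⇒≈ᶜ : ∀ {x y} → chr p (lin 𝔄) x ≡ chr p (lin 𝔄) y → character p 𝔄 x ≈ᶜ character p 𝔄 y
    chr⇒≈ᶜ {x} {y} eq = color-≡ s ,
      ≈⇒≡ {𝔄 = 𝔄 ↾< x} {𝔄 ↾< y} (≅⇒≈ (lin-↾< 𝔄 x) ⨾ below s ⨾ ≈-sym (≅⇒≈ (lin-↾< 𝔄 y))) ,
      ≈⇒≡ {𝔄 = 𝔄 ↾> x} {𝔄 ↾> y} (≅⇒≈ (lin-↾> 𝔄 x) ⨾ above s ⨾ ≈-sym (≅⇒≈ (lin-↾> 𝔄 y)))
      where s = chr⇒Similar {A = lin 𝔄} {B = lin 𝔄} {x = x} {y} eq

    ≈ᶜ⇒chr : ∀ {x y} → character p 𝔄 x ≈ᶜ character p 𝔄 y → chr p (lin 𝔄) x ≡ chr p (lin 𝔄) y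
    ≈ᶜ⇒chr {x} {y} (q , r , s) = Similar⇒chr {A = lin 𝔄} {B = lin 𝔄} {x = x} {y} (similar q
      (≈-sym (≅⇒≈ (lin-↾< 𝔄 x)) ⨾ ≡⇒≈ {𝔄 = 𝔄 ↾< x} {𝔄 ↾< y} 1≤p r ⨾ ≅⇒≈ (lin-↾< 𝔄 y))
      (≈-sym (≅⇒≈ (lin-↾> 𝔄 x)) ⨾ ≡⇒≈ {𝔄 = 𝔄 ↾> x} {𝔄 ↾> y} 1≤p s ⨾ ≅⇒≈ (lin-↾> 𝔄 y)))

    -- Injectivity rests on the definability of types, surjectivity on the game.
    cardinality : HasCardinality (Character d a p) (ρ p 𝔄) (length realised)
    cardinality = record
      { to        = λ i → character p 𝔄 (proj₁ (point-of i)) , proj₁ (point-of i) , Ch.refl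
      ; cong      = λ { refl → Ch.refl }
      ; bijective =
          (λ {i} {j} eq → lookup-injective (Unique.filter⁺ _ (Unique.allFin⁺ (#char p))) i j
            (trans (sym (proj₂ (point-of i))) (trans (≈ᶜ⇒chr eq) (proj₂ (point-of j))))) ,
          λ { (c , x , eq) → Any.index (chr∈realised x) , λ { refl →
            Ch.trans (chr⇒≈ᶜ (trans (proj₂ (point-of _)) (sym (lookup-index (chr∈realised x)))))
                     (Ch.sym eq) } }
      }

theorem7 :
    (∀ {ℓ : Level} → ExcludedMiddle ℓ) →
    ∀ {a : Level} {d q : ℕ} → 1 ≤ d → 2 ≤ q →
    (𝔄 : ColoredOrdinal d a) →
    ∃[ k ] HasCardinality (Character d a (q ∸ 1)) (ρ (q ∸ 1) 𝔄) k ×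
      (Σ[ 𝔅 ∈ ColoredOrdinal d 0ℓ ]
        (𝔅 ≡[ q ] 𝔄) × (ColoredOrdinal.otp 𝔅 ≼ ω ^ᴼ k))
theorem7 em {d = d} {q = suc p} _ (s≤s 1≤p) 𝔄 =
  let W , eq , E = collapse-order (lin 𝔄) (ColoredOrdinal.<-wellFounded 𝔄)
                     (realised 𝔄 p 1≤p) (chr∈realised 𝔄 p 1≤p)
  in length (realised 𝔄 p 1≤p) , cardinality 𝔄 p 1≤p , coloredOrdinal W E ,
     ≈⇒≡ (≅⇒≈ (lin-coloredOrdinal W E) ⨾ ≈-sym eq) , ordinal-≼ W E
  where
  open Types em d
  open Logic em d
  open Realisation em d
  open Bounds em d p
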